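{- Let $f(t),g(t)\in\mathbb{C}[[t]]$ be a delta series and an invertible series respectively, and let $r\ge 1$ be an integer. For every $n\ge0$, the Legendre-Gould Hopper based Sheffer polynomials satisfy $${}_{{}_{s}LeG^{(r)}}s_{n}(x,y,z)=\int_{0}^{\infty} e^{ -s}\;{}_{{}_{s}LeG^{(r)}}s_{n}(x,y,sD_{z}^{ -1})\,ds.$$
   Context: A delta series is $f\in\mathbb{C}[[t]]$ with $f(0)=0$, $f'(0)\neq 0$; $f^{ -1}$ denotes its compositional inverse. An invertible series is $g\in\mathbb{C}[[t]]$ with $g(0)\ne 0$. $C_0(x)=\sum_{k\ge 0}\frac{(-1)^k x^k}{(k!)^2}$. $D_z^{ -1}$ is the inverse derivative operator in $z$, $D_z^{ -1}h=\int_0^z h\,d\zeta$, so $D_z^{ -k}\{1\}=z^k/k!$. For a polynomial $p(x,y,z)=\sum_k p_k(x,y)z^k$, the expression $p(x,y,sD_z^{ -1})$ means the operator obtained by substituting $sD_z^{ -1}$ for $z$, applied to the constant $1$: $p(x,y,sD_z^{ -1})=\sum_k p_k(x,y)s^kD_z^{ -k}\{1\}=\sum_k p_k(x,y)\frac{s^kz^k}{k!}$. The polynomials are determined by the generating function $$\frac{1}{g(f^{ -1}(t))}\,C_0\!\left(-x\,(f^{ -1}(t))^2\right)\exp\!\left(y f^{ -1}(t)+z\,(f^{ -1}(t))^r\right)=\sum_{n=0}^{\infty}{}_{{}_{s}LeG^{(r)}}s_{n}(x,y,z)\frac{t^n}{n!}.$$ -}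

module Defs where

open import Level using (Level; _⊔_) renaming (suc to lsuc)
open import Data.Nat.Base as ℕ using (ℕ; zero; suc; NonZero; _!)
open import Data.Nat.Properties as ℕₚ using (_!≢0)
open import Data.Nat.GeneralisedArithmetic using (fold)
open import Data.Product.Base using (_×_; _,_; proj₁; proj₂; ∃-syntax)
open import Data.Sum.Base using (_⊎_; inj₁; inj₂)
open import Data.List.Base using (List; []; _∷_; map; length)
open import Data.Empty using (⊥-elim)
open import Function.Base using (id)
open import Relation.Nullary.Negation using (¬_)
open import Relation.Binary.Core using (Rel)
open import Relation.Binary.Structures using (IsStrictPartialOrder)
open import Relation.Binary.PropositionalEquality.Core as ≡ using (_≡_)
open import Algebra.Bundles using (CommutativeRing; CommutativeSemiring)
open import Algebra.Bundles.Raw using (RawRing)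
open import Algebra.Apartness.Bundles using (HeytingField; HeytingCommutativeRing)
import Algebra.Definitions.RawSemiring as RawSemiringOps
import Algebra.Properties.Ring as RingProperties
import Algebra.Properties.Semiring.Mult as SemiringMult
import Algebra.Apartness.Properties.HeytingCommutativeRing as HeytingProperties
import Algebra.Solver.Ring.NaturalCoefficients.Default as SemiringSolver
import Relation.Binary.Reasoning.Setoid as SetoidReasoning

------------------------------------------------------------------------
-- Finite sums, formal power series and polynomials over a ring A

module FiniteSum {a ℓ : Level} (A : RawRing a ℓ) where
  open RawRing A

  -- ∑< n u = u 0 + ⋯ + u (n - 1)
  ∑< : ℕ → (ℕ → Carrier) → Carrier
  ∑< zero    u = 0#
  ∑< (suc n) u = ∑< n u + u n

module PowerSeries {a ℓ : Level} (A : RawRing a ℓ) where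
  open RawRing A
  open FiniteSum A

  -- a stands for the formal series Σ a(n) tⁿ.
  Series : Set a
  Series = ℕ → Carrier

  infix 4 _≈ₛ_
  _≈ₛ_ : Series → Series → Set ℓ
  u ≈ₛ v = ∀ n → u n ≈ v n

  constant : Carrier → Series
  constant c zero    = c
  constant c (suc n) = 0#

  -- The series t.
  var : Series
  var (suc zero) = 1#
  var _          = 0#

  infixl 7 _*ₛ_
  _*ₛ_ : Series → Series → Series
  (u *ₛ v) n = ∑< (suc n) λ i → u i * v (n ℕ.∸ i)

  seriesRing : RawRing a ℓ
  seriesRing = record
    { Carrier = Series
    ; _≈_     = _≈ₛ_
    ; _+_     = λ u v n → u n + v n
    ; _*_     = _*ₛ_
    ; -_      = λ u n → - u n
    ; 0#      = constant 0#
    ; 1#      = constant 1#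
    }

  open RawSemiringOps (RawRing.rawSemiring seriesRing) using (_^_)

  -- u(v(t)), for v without constant term: vᵏ then starts in degree k or
  -- later, so that only the terms k ≤ n of Σ u(k) vᵏ contribute to tⁿ.
  infixr 9 _∘ₛ_
  _∘ₛ_ : Series → Series → Series
  (u ∘ₛ v) n = ∑< (suc n) λ k → u k * (v ^ k) n

module Polynomials {a ℓ : Level} (A : RawRing a ℓ) where
  open RawRing A

  -- Coefficients in increasing degree; trailing zeros are allowed, and
  -- equality compares coefficients.
  Poly : Set a
  Poly = List Carrier

  coeff : Poly → ℕ → Carrier
  coeff []      k       = 0#
  coeff (c ∷ p) zero    = c
  coeff (c ∷ p) (suc k) = coeff p k

  infixl 6 _+ₚ_
  _+ₚ_ : Poly → Poly → Poly
  []      +ₚ q       = q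
  (c ∷ p) +ₚ []      = c ∷ p
  (c ∷ p) +ₚ (d ∷ q) = (c + d) ∷ (p +ₚ q)

  infixl 7 _*ₚ_
  _*ₚ_ : Poly → Poly → Poly
  []      *ₚ q = []
  (c ∷ p) *ₚ q = map (c *_) q +ₚ (0# ∷ (p *ₚ q))

  C : Carrier → Poly
  C c = c ∷ []

  X : Poly
  X = 0# ∷ 1# ∷ []

  polyRing : RawRing a ℓ
  polyRing = record
    { Carrier = Poly
    ; _≈_     = λ p q → ∀ k → coeff p k ≈ coeff q k
    ; _+_     = _+ₚ_
    ; _*_     = _*ₚ_
    ; -_      = map (-_)
    ; 0#      = []
    ; 1#      = C 1#
    }

-- Evaluation of a polynomial over A at b, the coefficients being sent to
-- B by φ.
module Evaluation {a ℓ b ℓ′ : Level} (A : RawRing a ℓ) (B : RawRing b ℓ′) where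
  open RawRing B
  open Polynomials A using (Poly)

  eval : (RawRing.Carrier A → Carrier) → Carrier → Poly → Carrier
  eval φ b []      = 0#
  eval φ b (c ∷ p) = φ c + b * eval φ b p

------------------------------------------------------------------------
-- The real numbers

module Convergence
  {c ℓ₁ ℓ₂ ℓ₃ : Level} (F : HeytingField c ℓ₁ ℓ₂)
  (_<_ : Rel (HeytingField.Carrier F) ℓ₃) where

  open HeytingField F

  -- ∣ x ∣< b says that the absolute value of x is smaller than b.
  ∣_∣<_ : Rel Carrier ℓ₃
  ∣ x ∣< b = ((- b) < x) × (x < b)

  Converges : (ℕ → Carrier) → Carrier → Set (c ⊔ ℓ₃)
  Converges u l =
    ∀ ε → 0# < ε → ∃[ N ] ∀ n → N ℕ.≤ n → ∣ u n - l ∣< ε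

  Cauchy : (ℕ → Carrier) → Set (c ⊔ ℓ₃)
  Cauchy u =
    ∀ ε → 0# < ε → ∃[ N ] ∀ m n → N ℕ.≤ m → N ℕ.≤ n → ∣ u m - u n ∣< ε

-- ℝ is specified, up to isomorphism, as the complete Archimedean ordered
-- field.  The axioms are the constructive ones: the order is not assumed
-- to be decidable and apartness (# : x < y or y < x) takes the role of
-- inequality.  Classically they amount to the usual axioms of ℝ.
record RealNumbers (c ℓ₁ ℓ₂ ℓ₃ : Level) :
    Set (lsuc (c ⊔ ℓ₁ ⊔ ℓ₂ ⊔ ℓ₃)) where
  field
    heytingField : HeytingField c ℓ₁ ℓ₂


  open HeytingField heytingField public

  infix 4 _<_
  field
    _<_                  : Rel Carrier ℓ₃
    isStrictPartialOrder : IsStrictPartialOrder _≈_ _<_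
    #⇒<⊎>                : ∀ {x y} → x # y → x < y ⊎ y < x
    <⇒#                  : ∀ {x y} → x < y → x # y
    +-monoˡ-<            : ∀ z {x y} → x < y → x + z < y + z
    *-pos                : ∀ {x y} → 0# < x → 0# < y → 0# < x * y

  commutativeRing : CommutativeRing c ℓ₁
  commutativeRing = HeytingCommutativeRing.commutativeRing
    (HeytingField.heytingCommutativeRing heytingField)

  open CommutativeRing commutativeRing public
    using (ring; rawRing; semiring; commutativeSemiring; +-abelianGroup)
  open RawSemiringOps (RawRing.rawSemiring rawRing) public
    using (_^_) renaming (_×_ to _·_)
  open Convergence heytingField _<_ public

  field
    archimedean : ∀ x → ∃[ n ] x < n · 1#
    complete    : ∀ u → Cauchy u → ∃[ l ] Converges u l

  infix 4 _≤_
  _≤_ : Rel Carrier ℓ₃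
  x ≤ y = ¬ (y < x)

------------------------------------------------------------------------
-- Order lemmas and reciprocals of positive integers

module OrderedField {c ℓ₁ ℓ₂ ℓ₃ : Level} (R : RealNumbers c ℓ₁ ℓ₂ ℓ₃) where
  open RealNumbers R
  open IsStrictPartialOrder isStrictPartialOrder public
    using (<-respʳ-≈; <-respˡ-≈)
    renaming (trans to <-trans; irrefl to <-irrefl; asym to <-asym)
  open RingProperties ring public
  open HeytingProperties (HeytingField.heytingCommutativeRing heytingField)
    using (1#0; x-0≈x; invertibleˡ⇒#)
  open SemiringMult semiring using (×1-homo-*; ×-homo-+; ×-congˡ)
  open FiniteSum rawRing
  open SemiringSolver commutativeSemiring
    using (solve; _:=_; _:+_; _:*_)

  +-monoʳ-< : ∀ z {x y} → x < y → z + x < z + y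
  +-monoʳ-< z x<y =
    <-respˡ-≈ (+-comm _ _) (<-respʳ-≈ (+-comm _ _) (+-monoˡ-< z x<y))

  +-mono-< : ∀ {x y u v} → x < y → u < v → x + u < y + v
  +-mono-< x<y u<v = <-trans (+-monoˡ-< _ x<y) (+-monoʳ-< _ u<v)

  neg-mono-< : ∀ {x y} → x < y → - y < - x
  neg-mono-< {x} {y} x<y =
    <-respˡ-≈ (trans (sym (+-assoc _ _ _)) (trans (+-congʳ (-‿inverseʳ x)) (+-identityˡ _)))
      (<-respʳ-≈ (trans (+-congˡ (+-comm _ _)) (trans (sym (+-assoc _ _ _))
                   (trans (+-congʳ (-‿inverseʳ y)) (+-identityˡ _))))
        (+-monoˡ-< (- x + - y) x<y))

  neg-<0 : ∀ {x} → x < 0# → 0# < - x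
  neg-<0 x<0 = <-respˡ-≈ -0#≈0# (neg-mono-< x<0)

  0<1 : 0# < 1#
  0<1 with #⇒<⊎> 1#0
  ... | inj₂ 0<1 = 0<1
  ... | inj₁ 1<0 = ⊥-elim (<-asym 1<0
    (<-respʳ-≈ -1*-1≈1 (*-pos (neg-<0 1<0) (neg-<0 1<0))))
    where
    -1*-1≈1 : - 1# * - 1# ≈ 1#
    -1*-1≈1 = trans (-1*x≈-x (- 1#)) (-‿involutive 1#)

  pos+pos : ∀ {x y} → 0# < x → 0# < y → 0# < x + y
  pos+pos 0<x 0<y = <-respˡ-≈ (+-identityˡ 0#) (+-mono-< 0<x 0<y)

  0<n·1 : ∀ n → .{{NonZero n}} → 0# < n · 1#
  0<n·1 (suc zero)        = <-respʳ-≈ (sym (+-identityʳ 1#)) 0<1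
  0<n·1 (suc n@(suc _)) = pos+pos 0<1 (0<n·1 n)

  inverse : ∀ {x} → 0# < x → Carrier
  inverse 0<x = proj₁ (#⇒invertible (#-sym (<⇒# 0<x)))

  *-inverseʳ : ∀ {x} (0<x : 0# < x) → x * inverse 0<x ≈ 1#
  *-inverseʳ {x} 0<x = trans (*-congʳ (sym (x-0≈x x)))
    (proj₂ (proj₂ (#⇒invertible (#-sym (<⇒# 0<x)))))

  1/_ : (n : ℕ) → .{{NonZero n}} → Carrier
  1/ n = inverse (0<n·1 n)

  1/factorial : ℕ → Carrier
  1/factorial k = (1/ (k !)) {{k !≢0}}

  inverse-pos : ∀ {x} (0<x : 0# < x) → 0# < inverse 0<x
  inverse-pos {x} 0<x = positive (#⇒<⊎> i#0)
    where
    i = inverse 0<x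

    i#0 : i # 0#
    i#0 = invertibleˡ⇒# (x , trans (*-congˡ (x-0≈x i)) (*-inverseʳ 0<x))

    positive : i < 0# ⊎ 0# < i → 0# < i
    positive (inj₂ 0<i) = 0<i
    positive (inj₁ i<0) = ⊥-elim (<-asym 0<1 (<-respˡ-≈ 1≈0+1 (<-respʳ-≈ (-‿inverseˡ 1#)
        (+-monoˡ-< 1# (<-respʳ-≈ x*-i≈-1 (*-pos 0<x (neg-<0 i<0)))))))
      where
      x*-i≈-1 : x * - i ≈ - 1#
      x*-i≈-1 = trans (sym (-‿distribʳ-* x i)) (-‿cong (*-inverseʳ 0<x))
      1≈0+1 : 0# + 1# ≈ 1#
      1≈0+1 = +-identityˡ 1#

  *-monoˡ-< : ∀ {z x y} → 0# < z → x < y → z * x < z * y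
  *-monoˡ-< {z} {x} {y} 0<z x<y =
    <-respˡ-≈ (+-identityˡ _) (<-respʳ-≈ e (+-monoˡ-< (z * x) 0<z*[y-x]))
    where
    0<y-x : 0# < y - x
    0<y-x = <-respˡ-≈ (-‿inverseʳ x) (+-monoˡ-< (- x) x<y)
    0<z*[y-x] : 0# < z * (y - x)
    0<z*[y-x] = *-pos 0<z 0<y-x
    e : z * (y - x) + z * x ≈ z * y
    e = trans (sym (distribˡ z (y - x) x))
          (*-congˡ (trans (+-assoc _ _ _) (trans (+-congˡ (-‿inverseˡ x)) (+-identityʳ y))))

  *-monoʳ-< : ∀ {z x y} → 0# < z → x < y → x * z < y * z
  *-monoʳ-< 0<z x<y = <-respˡ-≈ (*-comm _ _) (<-respʳ-≈ (*-comm _ _) (*-monoˡ-< 0<z x<y))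

  ½ : Carrier
  ½ = 1/ 2

  0<½ : 0# < ½
  0<½ = inverse-pos (0<n·1 2)

  ½+½≈1 : ½ + ½ ≈ 1#
  ½+½≈1 = trans (sym (trans (distribʳ ½ 1# _) (+-cong (*-identityˡ ½)
    (trans (*-congʳ (+-identityʳ 1#)) (*-identityˡ ½))))) (*-inverseʳ (0<n·1 2))

  w+w*½ : ∀ w → (w + w) * ½ ≈ w
  w+w*½ w = trans (solve 2 (λ w h → (w :+ w) :* h := w :* (h :+ h)) refl w ½)
              (trans (*-congˡ ½+½≈1) (*-identityʳ w))

  halve-pos : ∀ {w} → 0# < w + w → 0# < w
  halve-pos 0<2w = <-respʳ-≈ (w+w*½ _) (*-pos 0<2w 0<½)

  ½+½-split : ∀ w → w * ½ + w * ½ ≈ w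
  ½+½-split w = trans (sym (distribʳ ½ w w)) (w+w*½ w)

  abs-cong : ∀ {x y b} → x ≈ y → ∣ x ∣< b → ∣ y ∣< b
  abs-cong x≈y (l , u) = <-respʳ-≈ x≈y l , <-respˡ-≈ x≈y u

  abs-congʳ : ∀ {x a b} → a ≈ b → ∣ x ∣< a → ∣ x ∣< b
  abs-congʳ a≈b (l , u) = <-respˡ-≈ (-‿cong a≈b) l , <-respʳ-≈ a≈b u

  abs-weaken : ∀ {x a b} → a < b → ∣ x ∣< a → ∣ x ∣< b
  abs-weaken a<b (l , u) = <-trans (neg-mono-< a<b) l , <-trans u a<b

  abs-+ : ∀ {x y a b} → ∣ x ∣< a → ∣ y ∣< b → ∣ x + y ∣< (a + b)
  abs-+ {a = a} {b} (l , u) (l′ , u′) =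
    <-respˡ-≈ (-‿+-comm a b) (+-mono-< l l′) , +-mono-< u u′

  abs-neg : ∀ {x a} → ∣ x ∣< a → ∣ - x ∣< a
  abs-neg {x} {a} (l , u) =
    neg-mono-< u , <-respʳ-≈ (-‿involutive a) (neg-mono-< l)

  abs-0 : ∀ {a} → 0# < a → ∣ 0# ∣< a
  abs-0 0<a = <-respʳ-≈ -0#≈0# (neg-mono-< 0<a) , 0<a

  0<a+x : ∀ {x a} → - a < x → 0# < a + x
  0<a+x {x} {a} -a<x = <-respˡ-≈ (-‿inverseʳ a) (+-monoʳ-< a -a<x)

  -a<x : ∀ {x a} → 0# < a + x → - a < x
  -a<x {x} {a} 0<a+x = <-respˡ-≈ (+-identityʳ _)
    (<-respʳ-≈ (trans (sym (+-assoc _ _ _)) (trans (+-congʳ (-‿inverseˡ a)) (+-identityˡ x)))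
      (+-monoʳ-< (- a) 0<a+x))

  product-pos : ∀ {x y a b} → ∣ x ∣< a → ∣ y ∣< b → 0# < a * b + x * y
  product-pos {x} {y} {a} {b} x<a y<b = halve-pos (<-respʳ-≈ e
    (pos+pos (*-pos (0<a+x (proj₁ (abs-neg x<a))) (0<a+x (proj₁ (abs-neg y<b))))
             (*-pos (0<a+x (proj₁ x<a)) (0<a+x (proj₁ y<b)))))
    where
    open SetoidReasoning setoid
    -x*-y≈xy : - x * - y ≈ x * y
    -x*-y≈xy = trans (sym (-‿distribˡ-* x (- y)))
      (trans (-‿cong (sym (-‿distribʳ-* x y))) (-‿involutive (x * y)))
    e : (a - x) * (b - y) + (a + x) * (b + y) ≈ (a * b + x * y) + (a * b + x * y)
    e = begin
      (a - x) * (b - y) + (a + x) * (b + y)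
        ≈⟨ solve 6 (λ a b x y x′ y′ →
             (a :+ x′) :* (b :+ y′) :+ (a :+ x) :* (b :+ y) :=
             (a :* b :+ a :* b :+ x :* y :+ x′ :* y′) :+ (a :* (y :+ y′) :+ b :* (x :+ x′)))
             refl a b x y (- x) (- y) ⟩
      (a * b + a * b + x * y + - x * - y) + (a * (y - y) + b * (x - x))
        ≈⟨ +-cong (+-congˡ -x*-y≈xy)
             (+-cong (trans (*-congˡ (-‿inverseʳ y)) (zeroʳ a))
                     (trans (*-congˡ (-‿inverseʳ x)) (zeroʳ b))) ⟩
      (a * b + a * b + x * y + x * y) + (0# + 0#)
        ≈⟨ trans (+-congˡ (+-identityʳ 0#)) (+-identityʳ _) ⟩
      a * b + a * b + x * y + x * y
        ≈⟨ solve 2 (λ p q → p :+ p :+ q :+ q := (p :+ q) :+ (p :+ q)) refl (a * b) (x * y) ⟩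
      (a * b + x * y) + (a * b + x * y) ∎

  abs-* : ∀ {x y a b} → ∣ x ∣< a → ∣ y ∣< b → ∣ x * y ∣< (a * b)
  abs-* {x} {y} {a} {b} x<a y<b =
    -a<x (product-pos x<a y<b) ,
    <-respˡ-≈ (-‿involutive _) (<-respʳ-≈ (-‿involutive _)
      (neg-mono-< (-a<x (<-respʳ-≈ (+-congˡ (sym (-‿distribʳ-* x y)))
        (product-pos x<a (abs-neg y<b))))))

  n·1-mono-≤ : ∀ {m n x} → m ℕ.≤ n → x < m · 1# → x < n · 1#
  n·1-mono-≤ {m} {n} {x} m≤n x<m with ℕₚ.m≤n⇒∃[o]m+o≡n m≤n
  ... | zero  , ≡.refl = <-respʳ-≈ (×-congˡ (≡.sym (ℕₚ.+-identityʳ m))) x<m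
  ... | suc o , ≡.refl = <-respʳ-≈ (sym (×-homo-+ 1# m (suc o)))
    (<-trans (<-respˡ-≈ (+-identityʳ x) (+-monoʳ-< x (0<n·1 (suc o)))) (+-monoˡ-< _ x<m))

  -- A natural number bound on |x|.
  bound : ∀ x → ∃[ n ] ∣ x ∣< (n · 1#)
  bound x with archimedean x | archimedean (- x)
  ... | m , x<m | n , -x<n =
    m ℕ.+ n ,
    <-respʳ-≈ (-‿involutive x)
      (neg-mono-< (n·1-mono-≤ (ℕₚ.m≤n+m n m) -x<n)) ,
    n·1-mono-≤ (ℕₚ.m≤m+n m n) x<m

  inverse-unique : ∀ {x y z} → x * y ≈ 1# → x * z ≈ 1# → y ≈ z
  inverse-unique {x} {y} {z} xy≈1 xz≈1 = begin
    y            ≈⟨ *-identityʳ y ⟨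
    y * 1#       ≈⟨ *-congˡ xz≈1 ⟨
    y * (x * z)  ≈⟨ solve 3 (λ x y z → y :* (x :* z) := (x :* y) :* z) refl x y z ⟩
    (x * y) * z  ≈⟨ *-congʳ xy≈1 ⟩
    1# * z       ≈⟨ *-identityˡ z ⟩
    z            ∎
    where open SetoidReasoning setoid

------------------------------------------------------------------------
-- The real exponential function, as the sum of its power series

module RealExponential {c ℓ₁ ℓ₂ ℓ₃ : Level} (R : RealNumbers c ℓ₁ ℓ₂ ℓ₃) where
  open RealNumbers R
  open OrderedField R
  open SemiringMult semiring using (×1-homo-*; ×-homo-+)
  open FiniteSum rawRing
  open SemiringSolver commutativeSemiring
    using (solve; _:=_; _:+_; _:*_)

  -- xᵏ / k!
  expTerm : Carrier → ℕ → Carrier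
  expTerm x k = x ^ k * 1/factorial k

  expSum : Carrier → ℕ → Carrier
  expSum x n = ∑< n (expTerm x)

  1/factorial-suc : ∀ k → 1/factorial (suc k) ≈ 1/factorial k * 1/ suc k
  1/factorial-suc k = inverse-unique (*-inverseʳ (0<n·1 (suc k !) {{suc k !≢0}})) (begin
    ((suc k ℕ.* k !) · 1#) * (p * q)         ≈⟨ *-congʳ (×1-homo-* (suc k) (k !)) ⟩
    (suc k · 1#) * ((k !) · 1#) * (p * q)
      ≈⟨ solve 4 (λ m n p q → m :* n :* (p :* q) := (m :* q) :* (n :* p)) refl _ _ p q ⟩
    ((suc k · 1#) * q) * (((k !) · 1#) * p)
      ≈⟨ *-cong (*-inverseʳ (0<n·1 (suc k))) (*-inverseʳ (0<n·1 (k !) {{k !≢0}})) ⟩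
    1# * 1#                                  ≈⟨ *-identityˡ 1# ⟩
    1#                                       ∎)
    where
    open SetoidReasoning setoid
    p = 1/factorial k
    q = 1/ suc k

  expTerm-suc : ∀ x k → expTerm x (suc k) ≈ expTerm x k * (x * 1/ suc k)
  expTerm-suc x k = trans (*-congˡ (1/factorial-suc k))
    (solve 4 (λ x y p q → x :* y :* (p :* q) := y :* p :* (x :* q)) refl x (x ^ k) _ (1/ suc k))

  -- Let |x| < M.  From the term of index K = 2M on, consecutive terms of
  -- the series shrink at least by the factor ½.
  module CauchyBound (x : Carrier) (M : ℕ) (x<M : ∣ x ∣< (M · 1#)) (B : Carrier)
    (t<B : ∣ expTerm x (M ℕ.+ M) ∣< B) where
    K : ℕ
    K = M ℕ.+ M

    ratio-small : ∀ k → K ℕ.≤ k → ∣ x * 1/ suc k ∣< ½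
    ratio-small k K≤k = abs-weaken M*q<½ (abs-scale x<M)
      where
      q = 1/ suc k
      0<q : 0# < q
      0<q = inverse-pos (0<n·1 (suc k))
      abs-scale : ∀ {y b} → ∣ y ∣< b → ∣ y * q ∣< (b * q)
      abs-scale {y} {b} (l , u) =
        <-respˡ-≈ (sym (-‿distribˡ-* b q)) (*-monoʳ-< 0<q l) , *-monoʳ-< 0<q u
      2M<suc-k : M · 1# + M · 1# < suc k · 1#
      2M<suc-k = <-respˡ-≈ (×-homo-+ 1# M M)
        (n·1-mono-≤ (ℕ.s≤s K≤k) (<-respˡ-≈ (+-identityˡ _) (+-monoˡ-< (K · 1#) 0<1)))
      M*q<½ : M · 1# * q < ½
      M*q<½ = <-respˡ-≈ (*-congʳ (w+w*½ (M · 1#)))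
        (<-respʳ-≈
          (trans (solve 3 (λ n h q → n :* h :* q := h :* (n :* q)) refl (suc k · 1#) ½ q)
            (trans (*-congˡ (*-inverseʳ (0<n·1 (suc k)))) (*-identityʳ ½)))
          (*-monoʳ-< 0<q (*-monoʳ-< 0<½ 2M<suc-k)))

    0<B : 0# < B
    0<B = halve-pos (<-trans (0<a+x (proj₁ t<B)) (+-monoʳ-< B (proj₂ t<B)))

    β : ℕ → Carrier
    β zero    = B
    β (suc j) = β j * ½

    0<β : ∀ j → 0# < β j
    0<β zero    = 0<B
    0<β (suc j) = *-pos (0<β j) 0<½

    term-bound : ∀ j → ∣ expTerm x (j ℕ.+ K) ∣< β j
    term-bound zero    = t<B
    term-bound (suc j) = abs-cong (sym (expTerm-suc x (j ℕ.+ K)))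
      (abs-* (term-bound j) (ratio-small (j ℕ.+ K) (ℕₚ.m≤n+m K j)))

    tail-bound : ∀ i j →
      ∣ expSum x (i ℕ.+ (j ℕ.+ K)) - expSum x (j ℕ.+ K) ∣< (β j + β j)
    tail-bound zero    j =
      abs-cong (sym (-‿inverseʳ _)) (abs-0 (pos+pos (0<β j) (0<β j)))
    tail-bound (suc i) j =
      abs-cong e (abs-congʳ (+-congʳ (½+½-split (β j)))
        (abs-+ (tail-bound i (suc j)) (term-bound j)))
      where
      open SetoidReasoning setoid
      n = j ℕ.+ K
      e : (expSum x (i ℕ.+ suc n) - expSum x (suc n)) + expTerm x n ≈
          expSum x (suc i ℕ.+ n) - expSum x n
      e = begin
        (expSum x (i ℕ.+ suc n) - (expSum x n + expTerm x n)) + expTerm x n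
          ≡⟨ ≡.cong (λ m → (expSum x m - (expSum x n + expTerm x n)) + expTerm x n)
               (ℕₚ.+-suc i n) ⟩
        (s - (expSum x n + expTerm x n)) + expTerm x n
          ≈⟨ +-congʳ (+-congˡ (-‿+-comm _ _)) ⟨
        (s + (- expSum x n + - expTerm x n)) + expTerm x n
          ≈⟨ solve 4 (λ s a t′ t → (s :+ (a :+ t′)) :+ t := (s :+ a) :+ (t′ :+ t))
               refl s _ (- expTerm x n) (expTerm x n) ⟩
        (s - expSum x n) + (- expTerm x n + expTerm x n)
          ≈⟨ trans (+-congˡ (-‿inverseˡ _)) (+-identityʳ _) ⟩
        s - expSum x n ∎
        where s = expSum x (suc i ℕ.+ n)

    β<2B : ∀ j → β j < B + B
    β<2B zero    = <-respˡ-≈ (+-identityˡ B) (+-monoˡ-< B 0<B)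
    β<2B (suc j) = <-trans (<-respʳ-≈ (½+½-split (β j))
      (<-respˡ-≈ (+-identityˡ _) (+-monoˡ-< (β (suc j)) (0<β (suc j))))) (β<2B j)

    jβ<2B : ∀ j → (j · 1#) * β j < B + B
    jβ<2B zero    = <-respˡ-≈ (sym (zeroˡ B)) (pos+pos 0<B 0<B)
    jβ<2B (suc j) = <-respˡ-≈
      (trans (*-congʳ (+-congʳ (sym (*-identityˡ (β j)))))
        (solve 4 (λ o n b h → (o :* b :+ n :* b) :* h := (o :+ n) :* (b :* h))
          refl 1# (j · 1#) (β j) ½))
      (<-respʳ-≈ (w+w*½ (B + B)) (*-monoʳ-< 0<½ (+-mono-< (β<2B j) (jβ<2B j))))

    β-small : ∀ ε → 0# < ε → ∃[ j ] β j + β j < ε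
    β-small ε 0<ε with archimedean ((B + B + (B + B)) * inverse 0<ε)
    ... | n , 4B/ε<n = suc n ,
      <-respˡ-≈ (cancel _) (<-respʳ-≈ (cancel _)
        (*-monoˡ-< (inverse-pos 0<N) (<-trans Nβ<4B 4B<Nε)))
      where
      N = suc n · 1#
      0<N : 0# < N
      0<N = 0<n·1 (suc n)
      4B<Nε : B + B + (B + B) < N * ε
      4B<Nε = <-respˡ-≈
        (trans (*-assoc _ _ ε) (trans (*-congˡ (trans (*-comm _ ε) (*-inverseʳ 0<ε)))
          (*-identityʳ _)))
        (*-monoʳ-< 0<ε (n·1-mono-≤ (ℕₚ.n≤1+n n) 4B/ε<n))
      Nβ<4B : N * (β (suc n) + β (suc n)) < B + B + (B + B)
      Nβ<4B = <-respˡ-≈ (sym (distribˡ N _ _)) (+-mono-< (jβ<2B (suc n)) (jβ<2B (suc n)))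
      cancel : ∀ w → inverse 0<N * (N * w) ≈ w
      cancel w = trans (sym (*-assoc _ N w))
        (trans (*-congʳ (trans (*-comm _ N) (*-inverseʳ 0<N))) (*-identityˡ w))

    difference : ∀ a b s → (a - s) + - (b - s) ≈ a - b
    difference a b s =
      trans (+-congˡ (trans (sym (-‿+-comm _ _)) (+-congˡ (-‿involutive s))))
        (trans (solve 4 (λ a s′ b s → (a :+ s′) :+ (b :+ s) := (a :+ b) :+ (s′ :+ s))
                 refl a (- s) (- b) s)
          (trans (+-congˡ (-‿inverseˡ s)) (+-identityʳ _)))

    near : ∀ j m → j ℕ.+ K ℕ.≤ m → ∣ expSum x m - expSum x (j ℕ.+ K) ∣< (β j + β j)
    near j m N≤m = ≡.subst (λ k → ∣ expSum x k - expSum x (j ℕ.+ K) ∣< (β j + β j))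
      (ℕₚ.m∸n+n≡m N≤m) (tail-bound (m ℕ.∸ (j ℕ.+ K)) j)

    cauchy : Cauchy (expSum x)
    cauchy ε 0<ε = proj₁ small ℕ.+ K , λ m n N≤m N≤n →
      abs-cong (difference _ _ _) (abs-congʳ (½+½-split ε)
        (abs-+ (abs-weaken (proj₂ small) (near (proj₁ small) m N≤m))
               (abs-neg (abs-weaken (proj₂ small) (near (proj₁ small) n N≤n)))))
      where
      small : ∃[ j ] β j + β j < ε * ½
      small = β-small (ε * ½) (*-pos 0<ε 0<½)

  abstract
    expSum-cauchy : ∀ x → Cauchy (expSum x)
    expSum-cauchy x with bound x
    ... | M , x<M with bound (expTerm x (M ℕ.+ M))
    ... | n , t<n = CauchyBound.cauchy x M x<M (n · 1#) t<n

  exp : Carrier → Carrier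
  exp x = proj₁ (complete (expSum x) (expSum-cauchy x))

  exp-converges : ∀ x → Converges (expSum x) (exp x)
  exp-converges x = proj₂ (complete (expSum x) (expSum-cauchy x))

------------------------------------------------------------------------
-- The complex numbers

module Complex {c ℓ₁ ℓ₂ ℓ₃ : Level} (R : RealNumbers c ℓ₁ ℓ₂ ℓ₃) where
  open RealNumbers R

  record ℂ : Set c where
    constructor _+i_
    field
      re im : Carrier
  open ℂ public

  fromℝ : Carrier → ℂ
  fromℝ x = x +i 0#

  complexRing : RawRing c ℓ₁
  complexRing = record
    { Carrier = ℂ
    ; _≈_     = λ w v → (re w ≈ re v) × (im w ≈ im v)
    ; _+_     = λ w v → (re w + re v) +i (im w + im v)
    ; _*_     = λ w v → (re w * re v - im w * im v) +i (re w * im v + im w * re v)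
    ; -_      = λ w → (- re w) +i (- im w)
    ; 0#      = fromℝ 0#
    ; 1#      = fromℝ 1#
    }

  module ℂ-Ring = RawRing complexRing

  -- |w - v| < ε, for ε > 0.
  Within : Carrier → ℂ → ℂ → Set ℓ₃
  Within ε w v = (re w - re v) ^ 2 + (im w - im v) ^ 2 < ε ^ 2

------------------------------------------------------------------------
-- Riemann integrals of complex valued functions of a real variable

module Integration {c ℓ₁ ℓ₂ ℓ₃ : Level} (R : RealNumbers c ℓ₁ ℓ₂ ℓ₃) where
  open RealNumbers R renaming (Carrier to ℝ)
  open Complex R
  open FiniteSum complexRing

  -- Only point 0, …, point size and tag 0, …, tag (size - 1) matter.
  record TaggedPartition (a b : ℝ) : Set (c ⊔ ℓ₁ ⊔ ℓ₃) where
    field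
      size      : ℕ
      point     : ℕ → ℝ
      tag       : ℕ → ℝ
      start     : point 0 ≈ a
      end       : point size ≈ b
      point≤tag : ∀ i → i ℕ.< size → point i ≤ tag i
      tag≤point : ∀ i → i ℕ.< size → tag i ≤ point (suc i)

    width : ℕ → ℝ
    width i = point (suc i) - point i

  open TaggedPartition

  Mesh<_ : ∀ {a b} → ℝ → TaggedPartition a b → Set ℓ₃
  (Mesh< δ) P = ∀ i → i ℕ.< size P → width P i < δ

  riemannSum : ∀ {a b} → (ℝ → ℂ) → TaggedPartition a b → ℂ
  riemannSum φ P = ∑< (size P) λ i → φ (tag P i) ℂ-Ring.* fromℝ (width P i)

  -- I = ∫ₐᵇ φ(s) ds, for a ≤ b.
  HasIntegral : ℝ → ℝ → (ℝ → ℂ) → ℂ → Set (c ⊔ ℓ₁ ⊔ ℓ₃)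
  HasIntegral a b φ I =
    ∀ ε → 0# < ε → ∃[ δ ] 0# < δ ×
      (∀ (P : TaggedPartition a b) → (Mesh< δ) P → Within ε (riemannSum φ P) I)

  -- I = ∫₀^∞ φ(s) ds, the limit of ∫₀ᵀ φ(s) ds as T → ∞.
  record HasIntegral₀^∞ (φ : ℝ → ℂ) (I : ℂ) : Set (c ⊔ ℓ₁ ⊔ ℓ₃) where
    field
      partial     : ∀ T → 0# ≤ T → ℂ
      isIntegral  : ∀ T (0≤T : 0# ≤ T) → HasIntegral 0# T φ (partial T 0≤T)
      convergence : ∀ ε → 0# < ε →
        ∃[ T₀ ] ∀ T (0≤T : 0# ≤ T) → T₀ ≤ T → Within ε (partial T 0≤T) I

------------------------------------------------------------------------
-- The polynomials and the operator substitution z ↦ s D_z⁻¹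

module LegendreGouldHopper
  {c ℓ₁ ℓ₂ ℓ₃ : Level} (R : RealNumbers c ℓ₁ ℓ₂ ℓ₃) where
  open OrderedField R using (1/_; 1/factorial)
  open Complex R

  -- ℂ[x,y,z] = ℂ[x][y][z]
  ℂ[x] ℂ[x,y] ℂ[x,y,z] : RawRing c ℓ₁
  ℂ[x]     = Polynomials.polyRing complexRing
  ℂ[x,y]   = Polynomials.polyRing ℂ[x]
  ℂ[x,y,z] = Polynomials.polyRing ℂ[x,y]

  module ℂ[z]     = Polynomials complexRing
  module ℂ[x][y]  = Polynomials ℂ[x]
  module ℂ[xy][z] = Polynomials ℂ[x,y]

  Polynomial : Set c
  Polynomial = RawRing.Carrier ℂ[x,y,z]

  ι : ℂ → Polynomial
  ι w = ℂ[xy][z].C (ℂ[x][y].C (ℂ[z].C w))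

  X Y Z : Polynomial
  X = ℂ[xy][z].C (ℂ[x][y].C ℂ[z].X)
  Y = ℂ[xy][z].C ℂ[x][y].X
  Z = ℂ[xy][z].X

  evaluate₁ : ℂ → List ℂ → ℂ
  evaluate₁ = Evaluation.eval complexRing complexRing id

  evaluate₂ : ℂ → ℂ → RawRing.Carrier ℂ[x,y] → ℂ
  evaluate₂ x y = Evaluation.eval ℂ[x] complexRing (evaluate₁ x) y

  evaluate₃ : ℂ → ℂ → ℂ → Polynomial → ℂ
  evaluate₃ x y z = Evaluation.eval ℂ[x,y] complexRing (evaluate₂ x y) z

  -- D_z⁻¹ on ℂ[z]: the antiderivative that vanishes at 0, which maps
  -- Σ cⱼ zʲ to Σ cⱼ zʲ⁺¹ / (j + 1).
  D⁻¹ : List ℂ → List ℂ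
  D⁻¹ p = ℂ-Ring.0# ∷ divide 0 p
    where
    divide : ℕ → List ℂ → List ℂ
    divide j []      = []
    divide j (w ∷ p) = w ℂ-Ring.* fromℝ (1/ suc j) ∷ divide (suc j) p

  open FiniteSum complexRing
  open RawSemiringOps (RawRing.rawSemiring complexRing)
    using () renaming (_^_ to _^ᶜ_)

  -- p(x, y, s D_z⁻¹) = Σ pₖ(x, y) sᵏ D_z⁻ᵏ{1}, evaluated at z.
  evaluate-sD⁻¹ : ℂ → ℂ → ℂ → ℂ → Polynomial → ℂ
  evaluate-sD⁻¹ x y s z p = ∑< (length p) λ k →
    evaluate₂ x y (ℂ[xy][z].coeff p k) ℂ-Ring.* s ^ᶜ k
      ℂ-Ring.* evaluate₁ z (fold (ℂ[z].C ℂ-Ring.1#) D⁻¹ k)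

  module ℂ[[t]] = PowerSeries complexRing
  open ℂ[[t]] public using (Series; _≈ₛ_; _∘ₛ_; _*ₛ_)

  record IsDelta (f : Series) : Set ℓ₁ where
    field
      f[0]≈0  : f 0 ℂ-Ring.≈ ℂ-Ring.0#
      f′[0]≉0 : ¬ (f 1 ℂ-Ring.≈ ℂ-Ring.0#)

  IsInvertible : Series → Set ℓ₁
  IsInvertible g = ¬ (g 0 ℂ-Ring.≈ ℂ-Ring.0#)

  record IsCompositionalInverse (f f⁻¹ : Series) : Set ℓ₁ where
    field
      f⁻¹[0]≈0 : f⁻¹ 0 ℂ-Ring.≈ ℂ-Ring.0#
      inverseʳ : f ∘ₛ f⁻¹ ≈ₛ ℂ[[t]].var
      inverseˡ : f⁻¹ ∘ₛ f ≈ₛ ℂ[[t]].var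

  -- v = 1 / u
  IsReciprocal : Series → Series → Set ℓ₁
  IsReciprocal u v = u *ₛ v ≈ₛ ℂ[[t]].constant ℂ-Ring.1#

  module ℂ[x,y,z][[t]] = PowerSeries ℂ[x,y,z]

  C₀ : ℂ[x,y,z][[t]].Series
  C₀ k = ι (fromℝ ((- 1#) ^ k * 1/factorial k ^ 2))
    where open RealNumbers R using (_*_; _^_; -_; 1#)

  Exp : ℂ[x,y,z][[t]].Series
  Exp k = ι (fromℝ (1/factorial k))

  -- C₀(-x f⁻¹(t)²) exp(y f⁻¹(t) + z f⁻¹(t)ʳ) / g(f⁻¹(t)), where v stands
  -- for 1 / g(f⁻¹(t)).
  generatingFunction : (f⁻¹ v : Series) → ℕ → ℂ[x,y,z][[t]].Series
  generatingFunction f⁻¹ v r =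
    (λ n → ι (v n)) *
    C₀ ∘ (- (constant X * F ^ 2)) *
    Exp ∘ (constant Y * F + constant Z * F ^ r)
    where
    open PowerSeries ℂ[x,y,z] renaming (_∘ₛ_ to _∘_)
    open RawRing (PowerSeries.seriesRing ℂ[x,y,z]) using (_+_; _*_; -_)
    open RawSemiringOps (RawRing.rawSemiring (PowerSeries.seriesRing ℂ[x,y,z])) using (_^_)
    F : PowerSeries.Series ℂ[x,y,z]
    F n = ι (f⁻¹ n)

  LeGs : (f⁻¹ v : Series) → ℕ → ℕ → Polynomial
  LeGs f⁻¹ v r n = (n ℕ.!) · generatingFunction f⁻¹ v r n
    where
    open RawSemiringOps (RawRing.rawSemiring ℂ[x,y,z]) renaming (_×_ to _·_)

module Setting {c ℓ₁ ℓ₂ ℓ₃ : Level} (R : RealNumbers c ℓ₁ ℓ₂ ℓ₃) where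
  open RealNumbers R public using (-_)
  open RealExponential R public using (exp)
  open Complex R public using (ℂ; fromℝ; module ℂ-Ring)
  open Integration R public using (HasIntegral₀^∞)
  open LegendreGouldHopper R public

{-# OPTIONS --safe #-}

-- Both sides are linear in the coefficients of the polynomial p in z, and
-- s D_z⁻¹ turns zᵏ into (sᵏ / k!) zᵏ, so that everything reduces to
-- ∫₀^∞ e⁻ˢ sᵏ / k! ds = 1.  A primitive of the integrand is
-- -e⁻ˢ (1 + s + ⋯ + sᵏ / k!).  Primitives are handled through a quadratic
-- bound on the remainder of the first order Taylor expansion, which passes
-- from the partial sums of exp to exp, controls Riemann sums directly, and
-- forces a function with derivative 0 to be constant.  The latter gives
-- e⁻ˢ eˢ = 1, hence e⁻ˢ sᵏ⁺¹ / (k + 1)! ≤ 1, so that the primitive tends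
-- to 0 at infinity.
module Submission where

open import Level using (Level; _⊔_)
open import Data.Nat.Base as ℕ using (ℕ; zero; suc)
import Data.Nat.Properties as ℕₚ
open import Data.Nat.GeneralisedArithmetic using (fold)
open import Data.Integer.Base as ℤ using (ℤ; -[1+_])
import Data.Integer.Properties as ℤₚ
open import Data.Sign.Base as Sign using (Sign)
open import Data.Maybe.Base using (Maybe; just; nothing)
open import Data.Product.Base using (_×_; _,_; proj₁; proj₂; ∃-syntax)
open import Data.Sum.Base using (_⊎_; inj₁; inj₂)
open import Data.List.Base using (List; []; _∷_; length)
open import Data.Empty using (⊥; ⊥-elim)
open import Relation.Nullary.Negation using (¬_)
open import Relation.Nullary.Decidable.Core using (yes; no)
import Relation.Binary.PropositionalEquality.Core as ≡
import Relation.Binary.Reasoning.Setoid as SetoidReasoning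
open import Algebra.Bundles using (CommutativeRing)
open import Algebra.Bundles.Raw using (RawRing)
open import Algebra.Solver.Ring.AlmostCommutativeRing
  using (_-Raw-AlmostCommutative⟶_; fromCommutativeRing)
import Algebra.Definitions.RawSemiring as RawSemiringOps
import Algebra.Properties.Ring as RingProperties
import Algebra.Properties.Semiring.Mult.TCOptimised as SemiringMult
import Algebra.Solver.Ring as RingSolver
import Algebra.Solver.Ring.NaturalCoefficients.Default as SemiringSolver
open import Defs

-- The order is not decidable and `_≤_` is a negated `_<_`, so the estimates do without maxima, the
-- mean value theorem and compactness. Instead every bound carries an explicit constant, and a sum
-- of nonnegative quantities replaces their maximum. A quadratic remainder with constant `K` gives
-- at once the error `K * δ * T` for a Riemann sum of mesh below `δ` on `[0, T]`, with no appeal to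
-- uniform continuity. It survives the passage from partial sums to `exp` because the single
-- constant `exp T` serves all partial sums on `[-T, T]`. The integrand is a product, hence the
-- closure of the class under products. The primitive has its form because differentiating a partial
-- sum of exp removes exactly its last term: in the derivative of `-e⁻ˢ (1 + ⋯ + sᵏ / k!)`
-- everything but `e⁻ˢ sᵏ / k!` cancels.

-- Normalising ring identities with integer coefficients

module IntegerCoefficients {c ℓ : Level} (R : CommutativeRing c ℓ) where
  open CommutativeRing R
  open RingProperties ring
  open SemiringMult semiring using (1+×; ×-homo-+; ×1-homo-*)
    renaming (_×_ to _·_)
  open SetoidReasoning setoid

  -- The multiple `_·_` is the variant in which `1 · 1#` is `1#` by definition, so that
  -- `con (ℤ.+ 1)` stands for `1#` itself in solved equations.
  fromℤ : ℤ → Carrier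
  fromℤ (ℤ.+ n)  = n · 1#
  fromℤ -[1+ n ] = - (suc n · 1#)

  fromℤ-⊖ : ∀ m n → fromℤ (m ℤ.⊖ n) ≈ m · 1# - n · 1#
  fromℤ-⊖ zero    zero    = sym (-‿inverseʳ 0#)
  fromℤ-⊖ zero    (suc n) = sym (+-identityˡ _)
  fromℤ-⊖ (suc m) zero    = sym (trans (+-congˡ -0#≈0#) (+-identityʳ _))
  fromℤ-⊖ (suc m) (suc n) = begin
    fromℤ (suc m ℤ.⊖ suc n)              ≡⟨ ≡.cong fromℤ (ℤₚ.[1+m]⊖[1+n]≡m⊖n m n) ⟩
    fromℤ (m ℤ.⊖ n)                      ≈⟨ fromℤ-⊖ m n ⟩
    m · 1# - n · 1#                      ≈⟨ +-identityˡ _ ⟨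
    0# + (m · 1# - n · 1#)               ≈⟨ +-congʳ (-‿inverseʳ 1#) ⟨
    (1# - 1#) + (m · 1# - n · 1#)
      ≈⟨ solve 4 (λ a a′ b b′ → (a :+ a′) :+ (b :+ b′) := (a :+ b) :+ (a′ :+ b′)) refl
           1# (- 1#) (m · 1#) (- (n · 1#)) ⟩
    (1# + m · 1#) + (- 1# - n · 1#)
      ≈⟨ +-cong (sym (1+× m 1#)) (trans (-‿+-comm _ _) (-‿cong (sym (1+× n 1#)))) ⟩
    suc m · 1# - suc n · 1#              ∎
    where open SemiringSolver commutativeSemiring using (solve; _:=_; _:+_)

  fromℤ-neg : ∀ i → fromℤ (ℤ.- i) ≈ - fromℤ i
  fromℤ-neg (ℤ.+ zero)  = sym -0#≈0#
  fromℤ-neg (ℤ.+ suc n) = refl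
  fromℤ-neg -[1+ n ]    = sym (-‿involutive _)

  fromℤ-+ : ∀ i j → fromℤ (i ℤ.+ j) ≈ fromℤ i + fromℤ j
  fromℤ-+ (ℤ.+ m)  (ℤ.+ n)  = ×-homo-+ 1# m n
  fromℤ-+ (ℤ.+ m)  -[1+ n ] = fromℤ-⊖ m (suc n)
  fromℤ-+ -[1+ m ] (ℤ.+ n)  = trans (fromℤ-⊖ n (suc m)) (+-comm _ _)
  fromℤ-+ -[1+ m ] -[1+ n ] = begin
    - (suc (suc (m ℕ.+ n)) · 1#)     ≡⟨ ≡.cong (λ k → - (suc k · 1#)) (≡.sym (ℕₚ.+-suc m n)) ⟩
    - ((suc m ℕ.+ suc n) · 1#)       ≈⟨ -‿cong (×-homo-+ 1# (suc m) (suc n)) ⟩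
    - (suc m · 1# + suc n · 1#)      ≈⟨ -‿+-comm _ _ ⟨
    - (suc m · 1#) - suc n · 1#      ∎

  fromℤ-* : ∀ i j → fromℤ (i ℤ.* j) ≈ fromℤ i * fromℤ j
  fromℤ-* (ℤ.+ m) (ℤ.+ n) = begin
    fromℤ (Sign.+ ℤ.◃ (m ℕ.* n))  ≡⟨ ≡.cong fromℤ (ℤₚ.+◃n≡+n (m ℕ.* n)) ⟩
    (m ℕ.* n) · 1#                ≈⟨ ×1-homo-* m n ⟩
    (m · 1#) * (n · 1#)           ∎
  fromℤ-* (ℤ.+ m) -[1+ n ] = begin
    fromℤ (Sign.- ℤ.◃ (m ℕ.* suc n))  ≡⟨ ≡.cong fromℤ (ℤₚ.-◃n≡-n (m ℕ.* suc n)) ⟩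
    fromℤ (ℤ.- (ℤ.+ (m ℕ.* suc n)))   ≈⟨ fromℤ-neg (ℤ.+ (m ℕ.* suc n)) ⟩
    - ((m ℕ.* suc n) · 1#)            ≈⟨ -‿cong (×1-homo-* m (suc n)) ⟩
    - ((m · 1#) * (suc n · 1#))       ≈⟨ -‿distribʳ-* _ _ ⟩
    (m · 1#) * - (suc n · 1#)         ∎
  fromℤ-* -[1+ m ] (ℤ.+ n) = begin
    fromℤ (Sign.- ℤ.◃ (suc m ℕ.* n))  ≡⟨ ≡.cong fromℤ (ℤₚ.-◃n≡-n (suc m ℕ.* n)) ⟩
    fromℤ (ℤ.- (ℤ.+ (suc m ℕ.* n)))   ≈⟨ fromℤ-neg (ℤ.+ (suc m ℕ.* n)) ⟩
    - ((suc m ℕ.* n) · 1#)            ≈⟨ -‿cong (×1-homo-* (suc m) n) ⟩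
    - ((suc m · 1#) * (n · 1#))       ≈⟨ -‿distribˡ-* _ _ ⟩
    - (suc m · 1#) * (n · 1#)         ∎
  fromℤ-* -[1+ m ] -[1+ n ] = begin
    (suc m ℕ.* suc n) · 1#              ≈⟨ ×1-homo-* (suc m) (suc n) ⟩
    (suc m · 1#) * (suc n · 1#)         ≈⟨ -‿involutive _ ⟨
    - - ((suc m · 1#) * (suc n · 1#))   ≈⟨ -‿cong (-‿distribˡ-* _ _) ⟩
    - (- (suc m · 1#) * (suc n · 1#))   ≈⟨ -‿distribʳ-* _ _ ⟩
    - (suc m · 1#) * - (suc n · 1#)     ∎

  homomorphism : ℤ.+-*-rawRing -Raw-AlmostCommutative⟶ fromCommutativeRing R
  homomorphism = record
    { ⟦_⟧    = fromℤ
    ; +-homo = fromℤ-+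
    ; *-homo = fromℤ-*
    ; -‿homo = fromℤ-neg
    ; 0-homo = refl
    ; 1-homo = refl
    }

  -- Distinct integers may still agree in the ring, so `nothing` refutes nothing; it only keeps two
  -- coefficients apart.
  fromℤ-≟ : ∀ i j → Maybe (fromℤ i ≈ fromℤ j)
  fromℤ-≟ i j with i ℤₚ.≟ j
  ... | yes i≡j = just (reflexive (≡.cong fromℤ i≡j))
  ... | no  _   = nothing

  open RingSolver ℤ.+-*-rawRing (fromCommutativeRing R) homomorphism fromℤ-≟ public
    using (solve; con; _:=_; _:+_; _:*_; _:-_; :-_)

-- Order and absolute value without trichotomy

module Inequalities {c ℓ₁ ℓ₂ ℓ₃ : Level} (R : RealNumbers c ℓ₁ ℓ₂ ℓ₃) where
  open RealNumbers R
  open OrderedField R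
  open IntegerCoefficients commutativeRing using (solve; _:=_; _:+_; _:*_; _:-_; :-_)

  -- Cotransitivity of apartness, applied to `y # z`, places `x` relative to one of the two; the
  -- unwanted order then contradicts `x ≤ y`.
  ≤-<-trans : ∀ {x y z} → x ≤ y → y < z → x < z
  ≤-<-trans {x} x≤y y<z with #-cotrans (<⇒# y<z) x
  ... | inj₁ y#x with #⇒<⊎> y#x
  ...   | inj₁ y<x = ⊥-elim (x≤y y<x)
  ...   | inj₂ x<y = <-trans x<y y<z
  ≤-<-trans {x} x≤y y<z | inj₂ x#z with #⇒<⊎> x#z
  ...   | inj₁ x<z = x<z
  ...   | inj₂ z<x = ⊥-elim (x≤y (<-trans y<z z<x))

  <-≤-trans : ∀ {x y z} → x < y → y ≤ z → x < z
  <-≤-trans {z = z} x<y y≤z with #-cotrans (<⇒# x<y) z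
  ... | inj₂ z#y with #⇒<⊎> z#y
  ...   | inj₁ z<y = ⊥-elim (y≤z z<y)
  ...   | inj₂ y<z = <-trans x<y y<z
  <-≤-trans {z = z} x<y y≤z | inj₁ x#z with #⇒<⊎> x#z
  ...   | inj₁ x<z = x<z
  ...   | inj₂ z<x = ⊥-elim (y≤z (<-trans z<x x<y))

  ≤-trans : ∀ {x y z} → x ≤ y → y ≤ z → x ≤ z
  ≤-trans x≤y y≤z z<x = y≤z (<-≤-trans z<x x≤y)

  <⇒≤ : ∀ {x y} → x < y → x ≤ y
  <⇒≤ = <-asym

  ≤-reflexive : ∀ {x y} → x ≈ y → x ≤ y
  ≤-reflexive x≈y = <-irrefl (sym x≈y)

  ≤-resp : ∀ {x y u v} → x ≈ u → y ≈ v → x ≤ y → u ≤ v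
  ≤-resp x≈u y≈v x≤y v<u = x≤y (<-respˡ-≈ (sym y≈v) (<-respʳ-≈ (sym x≈u) v<u))

  ≤-antisym : ∀ {x y} → x ≤ y → y ≤ x → x ≈ y
  ≤-antisym x≤y y≤x = proj₁ (tight _ _) λ x#y → absurd (#⇒<⊎> x#y)
    where
    absurd : _ → ⊥
    absurd (inj₁ x<y) = y≤x x<y
    absurd (inj₂ y<x) = x≤y y<x

  nonneg⇒≤ : ∀ {x y} → 0# ≤ y - x → x ≤ y
  nonneg⇒≤ {x} {y} 0≤y-x y<x = 0≤y-x (<-respʳ-≈ (-‿inverseʳ x) (+-monoˡ-< (- x) y<x))

  ≤⇒nonneg : ∀ {x y} → x ≤ y → 0# ≤ y - x
  ≤⇒nonneg {x} {y} x≤y y-x<0 = x≤y (<-respʳ-≈ (+-identityˡ x)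
    (<-respˡ-≈ (solve 2 (λ x y → y :- x :+ x := y) refl x y) (+-monoˡ-< x y-x<0)))

  ≤-+ˡ : ∀ {x y} → 0# ≤ x → y ≤ x + y
  ≤-+ˡ {x} {y} 0≤x = nonneg⇒≤ (≤-resp refl (solve 2 (λ x y → x := x :+ y :- y) refl x y) 0≤x)

  ≤-+ʳ : ∀ {x y} → 0# ≤ y → x ≤ x + y
  ≤-+ʳ 0≤y = ≤-resp refl (+-comm _ _) (≤-+ˡ 0≤y)

  nonneg-+ : ∀ {x y} → 0# ≤ x → 0# ≤ y → 0# ≤ x + y
  nonneg-+ 0≤x 0≤y = ≤-trans 0≤x (≤-+ʳ 0≤y)

  nonneg-halve : ∀ {x} → 0# ≤ x + x → 0# ≤ x
  nonneg-halve 0≤2x x<0 = 0≤2x (<-respʳ-≈ (+-identityʳ 0#) (+-mono-< x<0 x<0))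

  -- Since x ≤ y is a negation, its proofs may distinguish cases by sign.
  ¬¬-sign : ∀ x → ¬ ¬ (x < 0# ⊎ x ≈ 0# ⊎ 0# < x)
  ¬¬-sign x k = k (inj₂ (inj₁ (≤-antisym
    (λ 0<x → k (inj₂ (inj₂ 0<x))) (λ x<0 → k (inj₁ x<0)))))

  nonneg-* : ∀ {x y} → 0# ≤ x → 0# ≤ y → 0# ≤ x * y
  nonneg-* {x} {y} 0≤x 0≤y xy<0 = ¬¬-sign x λ
    { (inj₁ x<0)        → 0≤x x<0
    ; (inj₂ (inj₁ x≈0)) → <-irrefl (trans (*-congʳ x≈0) (zeroˡ y)) xy<0
    ; (inj₂ (inj₂ 0<x)) → ¬¬-sign y λ
      { (inj₁ y<0)        → 0≤y y<0
      ; (inj₂ (inj₁ y≈0)) → <-irrefl (trans (*-congˡ y≈0) (zeroʳ x)) xy<0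
      ; (inj₂ (inj₂ 0<y)) → <-asym xy<0 (*-pos 0<x 0<y)
      }
    }

  square-nonneg : ∀ x → 0# ≤ x * x
  square-nonneg x xx<0 = ¬¬-sign x λ
    { (inj₁ x<0)        → <-asym xx<0 (<-respʳ-≈
        (solve 1 (λ x → :- x :* :- x := x :* x) refl x) (*-pos (neg-<0 x<0) (neg-<0 x<0)))
    ; (inj₂ (inj₁ x≈0)) → <-irrefl (trans (*-congʳ x≈0) (zeroˡ x)) xx<0
    ; (inj₂ (inj₂ 0<x)) → <-asym xx<0 (*-pos 0<x 0<x)
    }

  pos+nonneg : ∀ {x y} → 0# < x → 0# ≤ y → 0# < x + y
  pos+nonneg 0<x 0≤y = <-≤-trans 0<x (≤-+ʳ 0≤y)

  <⇒pos : ∀ {x y} → x < y → 0# < y - x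
  <⇒pos {x} x<y = <-respˡ-≈ (-‿inverseʳ x) (+-monoˡ-< (- x) x<y)

  pos⇒< : ∀ {x y} → 0# < y - x → x < y
  pos⇒< {x} {y} 0<y-x = <-respˡ-≈ (+-identityˡ x)
    (<-respʳ-≈ (solve 2 (λ x y → y :- x :+ x := y) refl x y) (+-monoˡ-< x 0<y-x))

  *-cancel-inverse : ∀ {x} (0<x : 0# < x) y → x * (y * inverse 0<x) ≈ y
  *-cancel-inverse {x} 0<x y =
    trans (solve 3 (λ x y i → x :* (y :* i) := y :* (x :* i)) refl x y (inverse 0<x))
      (trans (*-congˡ (*-inverseʳ 0<x)) (*-identityʳ y))

  *-cancelʳ-< : ∀ {x y z} → 0# < z → x * z < y * z → x < y
  *-cancelʳ-< {x} {y} {z} 0<z xz<yz = <-respˡ-≈ (undo x) (<-respʳ-≈ (undo y)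
    (*-monoʳ-< (inverse-pos 0<z) xz<yz))
    where
    undo : ∀ w → w * z * inverse 0<z ≈ w
    undo w = trans (*-assoc w z _) (trans (*-congˡ (*-inverseʳ 0<z)) (*-identityʳ w))

  1/-nonneg : ∀ n → .{{_ : ℕ.NonZero n}} → 0# ≤ 1/ n
  1/-nonneg n = <⇒≤ (inverse-pos (0<n·1 n))

  -- In this form estimates reduce to sums and products of nonnegative terms.
  infix 4 ∣_∣≤_
  ∣_∣≤_ : Carrier → Carrier → Set ℓ₃
  ∣ x ∣≤ b = (0# ≤ b - x) × (0# ≤ b + x)

  abs≤-cong : ∀ {x y a b} → x ≈ y → a ≈ b → ∣ x ∣≤ a → ∣ y ∣≤ b
  abs≤-cong x≈y a≈b (l , u) =
    ≤-resp refl (+-cong a≈b (-‿cong x≈y)) l , ≤-resp refl (+-cong a≈b x≈y) u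

  abs≤-weaken : ∀ {x a b} → 0# ≤ b - a → ∣ x ∣≤ a → ∣ x ∣≤ b
  abs≤-weaken {x} {a} {b} a≤b (l , u) =
    ≤-resp refl (solve 3 (λ x a b → (b :- a) :+ (a :- x) := b :- x) refl x a b) (nonneg-+ a≤b l) ,
    ≤-resp refl (solve 3 (λ x a b → (b :- a) :+ (a :+ x) := b :+ x) refl x a b) (nonneg-+ a≤b u)

  abs≤-+ : ∀ {x y a b} → ∣ x ∣≤ a → ∣ y ∣≤ b → ∣ x + y ∣≤ (a + b)
  abs≤-+ {x} {y} {a} {b} (l , u) (l′ , u′) =
    ≤-resp refl (solve 4 (λ x y a b → (a :- x) :+ (b :- y) := a :+ b :- (x :+ y)) refl x y a b)
      (nonneg-+ l l′) ,
    ≤-resp refl (solve 4 (λ x y a b → (a :+ x) :+ (b :+ y) := a :+ b :+ (x :+ y)) refl x y a b)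
      (nonneg-+ u u′)

  abs≤-neg : ∀ {x a} → ∣ x ∣≤ a → ∣ - x ∣≤ a
  abs≤-neg {x} {a} (l , u) =
    ≤-resp refl (solve 2 (λ x a → a :+ x := a :- :- x) refl x a) u , l

  -- Twice each of `a * b - x * y` and `a * b + x * y` is a sum of products of the four nonnegative
  -- quantities `a ± x` and `b ± y`.
  abs≤-* : ∀ {x y a b} → ∣ x ∣≤ a → ∣ y ∣≤ b → ∣ x * y ∣≤ (a * b)
  abs≤-* {x} {y} {a} {b} (l , u) (l′ , u′) =
    nonneg-halve (≤-resp refl
      (solve 4 (λ x y a b → (a :- x) :* (b :+ y) :+ (a :+ x) :* (b :- y) :=
        (a :* b :- x :* y) :+ (a :* b :- x :* y)) refl x y a b)
      (nonneg-+ (nonneg-* l u′) (nonneg-* u l′))) ,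
    nonneg-halve (≤-resp refl
      (solve 4 (λ x y a b → (a :- x) :* (b :- y) :+ (a :+ x) :* (b :+ y) :=
        (a :* b :+ x :* y) :+ (a :* b :+ x :* y)) refl x y a b)
      (nonneg-+ (nonneg-* l l′) (nonneg-* u u′)))

  abs≤-nonneg : ∀ {x} → 0# ≤ x → ∣ x ∣≤ x
  abs≤-nonneg {x} 0≤x = ≤-reflexive (sym (-‿inverseʳ x)) , nonneg-+ 0≤x 0≤x

  abs≤-0 : ∀ {a} → 0# ≤ a → ∣ 0# ∣≤ a
  abs≤-0 0≤a = nonneg-+ 0≤a (≤-reflexive (sym -0#≈0#)) , nonneg-+ 0≤a (≤-reflexive refl)

  abs≤⇒nonneg : ∀ {x a} → ∣ x ∣≤ a → 0# ≤ a
  abs≤⇒nonneg {x} {a} (l , u) = nonneg-halve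
    (≤-resp refl (solve 2 (λ x a → (a :- x) :+ (a :+ x) := a :+ a) refl x a) (nonneg-+ l u))

  abs≤-0⇒≈0 : ∀ {x} → ∣ x ∣≤ 0# → x ≈ 0#
  abs≤-0⇒≈0 {x} (l , u) = ≤-antisym (nonneg⇒≤ l) (≤-resp refl (+-identityˡ x) u)

  abs≤-exists : ∀ x → ∃[ b ] ∣ x ∣≤ b
  abs≤-exists x = let n , (l , u) = bound x in n · 1# , <⇒≤ (<⇒pos u) , <⇒≤ (0<a+x l)

  abs<⇒pos : ∀ {x a} → ∣ x ∣< a → 0# < a
  abs<⇒pos {x} {a} x<a = halve-pos (<-respʳ-≈
    (solve 2 (λ x a → (a :+ x) :+ (a :- x) := a :+ a) refl x a)
    (pos+pos (0<a+x (proj₁ x<a)) (<⇒pos (proj₂ x<a))))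

  abs<-exists : ∀ x → ∃[ b ] ∣ x ∣< b
  abs<-exists x = let n , x<n = bound x in n · 1# , x<n

  abs≤⇒abs< : ∀ {x a b} → ∣ x ∣≤ a → a < b → ∣ x ∣< b
  abs≤⇒abs< {x} {a} {b} (l , u) a<b =
    pos⇒< (<-respʳ-≈ (solve 3 (λ x a b → (b :- a) :+ (a :+ x) := x :- :- b) refl x a b)
      (pos+nonneg (<⇒pos a<b) u)) ,
    pos⇒< (<-respʳ-≈ (solve 3 (λ x a b → (b :- a) :+ (a :- x) := b :- x) refl x a b)
      (pos+nonneg (<⇒pos a<b) l))

-- Limits of sequences

module Limits {c ℓ₁ ℓ₂ ℓ₃ : Level} (R : RealNumbers c ℓ₁ ℓ₂ ℓ₃) where
  open RealNumbers R
  open OrderedField R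
  open Inequalities R
  open IntegerCoefficients commutativeRing using (solve; con; _:=_; _:+_; _:*_; _:-_; :-_)

  converges-cong : ∀ {u v a b} → (∀ n → u n ≈ v n) → a ≈ b → Converges u a → Converges v b
  converges-cong u≈v a≈b u→a ε 0<ε with u→a ε 0<ε
  ... | N , close = N , λ n N≤n → abs-cong (+-cong (u≈v n) (-‿cong a≈b)) (close n N≤n)

  converges-const : ∀ a → Converges (λ _ → a) a
  converges-const a ε 0<ε = 0 , λ _ _ → abs-cong (sym (-‿inverseʳ a)) (abs-0 0<ε)

  converges-suc : ∀ {u a} → Converges u a → Converges (λ n → u (suc n)) a
  converges-suc u→a ε 0<ε with u→a ε 0<ε
  ... | N , close = N , λ n N≤n → close (suc n) (ℕₚ.m≤n⇒m≤1+n N≤n)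

  converges-+ : ∀ {u v a b} → Converges u a → Converges v b → Converges (λ n → u n + v n) (a + b)
  converges-+ {u} {v} {a} {b} u→a v→b ε 0<ε
    with u→a (ε * ½) (*-pos 0<ε 0<½) | v→b (ε * ½) (*-pos 0<ε 0<½)
  ... | N , close | N′ , close′ = N ℕ.+ N′ , λ n N+N′≤n →
    abs-cong
      (solve 4 (λ u v a b → (u :- a) :+ (v :- b) := u :+ v :- (a :+ b)) refl (u n) (v n) a b)
      (abs-congʳ (½+½-split ε) (abs-+
        (close n (ℕₚ.≤-trans (ℕₚ.m≤m+n N N′) N+N′≤n))
        (close′ n (ℕₚ.≤-trans (ℕₚ.m≤n+m N′ N) N+N′≤n))))

  converges-* : ∀ k {u a} → Converges u a → Converges (λ n → k * u n) (k * a)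
  converges-* k {u} {a} u→a ε 0<ε =
    let M , k<M = abs<-exists k
        0<M = abs<⇒pos k<M
        N , close = u→a (ε * inverse 0<M) (*-pos 0<ε (inverse-pos 0<M))
    in N , λ n N≤n →
      abs-cong (solve 3 (λ k u a → k :* (u :- a) := k :* u :- k :* a) refl k (u n) a)
        (abs-congʳ (*-cancel-inverse 0<M ε) (abs-* k<M (close n N≤n)))

  converges-neg : ∀ {u a} → Converges u a → Converges (λ n → - u n) (- a)
  converges-neg u→a = converges-cong (λ _ → -1*x≈-x _) (-1*x≈-x _) (converges-* (- 1#) u→a)

  limit-nonneg : ∀ {u a} N → (∀ n → N ℕ.≤ n → 0# ≤ u n) → Converges u a → 0# ≤ a
  -- If `a` were negative, closeness with `ε = - a` would make a late `u n` negative.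
  limit-nonneg {u} {a} N 0≤u u→a a<0 with u→a (- a) (neg-<0 a<0)
  ... | N′ , close = 0≤u n (ℕₚ.m≤m+n N N′) (pos⇒< (<-respʳ-≈
    (solve 2 (λ u a → :- a :- (u :- a) := con (ℤ.+ 0) :- u) refl (u n) a)
    (<⇒pos (proj₂ (close n (ℕₚ.m≤n+m N′ N))))))
    where n = N ℕ.+ N′

  limit-abs : ∀ {u a b} → (∀ n → ∣ u n ∣≤ b) → Converges u a → ∣ a ∣≤ b
  limit-abs {b = b} u≤b u→a =
    limit-nonneg 0 (λ n _ → proj₁ (u≤b n)) (converges-+ (converges-const b) (converges-neg u→a)) ,
    limit-nonneg 0 (λ n _ → proj₂ (u≤b n)) (converges-+ (converges-const b) u→a)

  limit-unique : ∀ {u a b} → Converges u a → Converges u b → a ≈ b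
  limit-unique {u} {a} {b} u→a u→b = ≤-antisym (below u→a u→b) (below u→b u→a)
    where
    below : ∀ {a b} → Converges u a → Converges u b → a ≤ b
    below u→a u→b = nonneg⇒≤ (limit-nonneg 0
      (λ n _ → ≤-reflexive (sym (-‿inverseʳ (u n)))) (converges-+ u→b (converges-neg u→a)))

-- Taylor remainders of the exponential series

module ExponentialBounds {c ℓ₁ ℓ₂ ℓ₃ : Level} (R : RealNumbers c ℓ₁ ℓ₂ ℓ₃) where
  open RealNumbers R
  open OrderedField R
  open RealExponential R
  open Inequalities R
  open Limits R
  open IntegerCoefficients commutativeRing using (solve; con; _:=_; _:+_; _:*_; _:-_; :-_)
  open SetoidReasoning setoid

  1/1≈1 : 1/ 1 ≈ 1#
  1/1≈1 = trans (sym (trans (*-congʳ (+-identityʳ 1#)) (*-identityˡ _))) (*-inverseʳ (0<n·1 1))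

  expTerm-zero : ∀ x → expTerm x 0 ≈ 1#
  expTerm-zero x = trans (*-identityˡ _) 1/1≈1

  expTerm-one : ∀ x → expTerm x 1 ≈ x
  expTerm-one x = begin
    expTerm x 1                ≈⟨ expTerm-suc x 0 ⟩
    expTerm x 0 * (x * 1/ 1)   ≈⟨ *-cong (expTerm-zero x) (*-congˡ 1/1≈1) ⟩
    1# * (x * 1#)              ≈⟨ trans (*-identityˡ _) (*-identityʳ x) ⟩
    x                          ∎

  *-expTerm : ∀ x k → x * expTerm x k ≈ (suc k · 1#) * expTerm x (suc k)
  *-expTerm x k = sym (begin
    (suc k · 1#) * expTerm x (suc k)               ≈⟨ *-congˡ (expTerm-suc x k) ⟩
    (suc k · 1#) * (expTerm x k * (x * 1/ suc k))
      ≈⟨ solve 4 (λ n e x i → n :* (e :* (x :* i)) := n :* i :* (x :* e)) refl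
           _ (expTerm x k) x (1/ suc k) ⟩
    (suc k · 1#) * 1/ suc k * (x * expTerm x k)    ≈⟨ *-congʳ (*-inverseʳ (0<n·1 (suc k))) ⟩
    1# * (x * expTerm x k)                         ≈⟨ *-identityˡ _ ⟩
    x * expTerm x k                                ∎)

  expTerm-cong : ∀ {x y} → x ≈ y → ∀ k → expTerm x k ≈ expTerm y k
  expTerm-cong x≈y zero    = refl
  expTerm-cong {x} {y} x≈y (suc k) = trans (expTerm-suc x k)
    (trans (*-cong (expTerm-cong x≈y k) (*-congʳ x≈y)) (sym (expTerm-suc y k)))

  expSum-cong : ∀ {x y} → x ≈ y → ∀ n → expSum x n ≈ expSum y n
  expSum-cong x≈y zero    = refl
  expSum-cong x≈y (suc n) = +-cong (expSum-cong x≈y n) (expTerm-cong x≈y n)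

  exp-cong : ∀ {x y} → x ≈ y → exp x ≈ exp y
  exp-cong {x} {y} x≈y = limit-unique
    (converges-cong (expSum-cong x≈y) refl (exp-converges x)) (exp-converges y)

  expTerm-zeroˡ : ∀ k → expTerm 0# (suc k) ≈ 0#
  expTerm-zeroˡ k = trans (*-congʳ (zeroˡ _)) (zeroˡ _)

  expSum-zeroˡ : ∀ n → expSum 0# (suc n) ≈ 1#
  expSum-zeroˡ zero    = trans (+-identityˡ _) (expTerm-zero 0#)
  expSum-zeroˡ (suc n) = trans (+-cong (expSum-zeroˡ n) (expTerm-zeroˡ n)) (+-identityʳ 1#)

  exp-0 : exp 0# ≈ 1#
  exp-0 = limit-unique (converges-suc (exp-converges 0#))
    (converges-cong (λ n → sym (expSum-zeroˡ n)) refl (converges-const 1#))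

  expTerm-abs : ∀ {x T} → ∣ x ∣≤ T → ∀ k → ∣ expTerm x k ∣≤ expTerm T k
  expTerm-abs {x} {T} x≤T zero = abs≤-cong (sym (expTerm-zero x)) (sym (expTerm-zero T))
    (abs≤-nonneg (<⇒≤ 0<1))
  expTerm-abs {x} {T} x≤T (suc k) = abs≤-cong (sym (expTerm-suc x k)) (sym (expTerm-suc T k))
    (abs≤-* (expTerm-abs x≤T k) (abs≤-* x≤T (abs≤-nonneg (1/-nonneg (suc k)))))

  expTerm-nonneg : ∀ {x} → 0# ≤ x → ∀ k → 0# ≤ expTerm x k
  expTerm-nonneg 0≤x k = abs≤⇒nonneg (expTerm-abs (abs≤-nonneg 0≤x) k)

  expSum-abs : ∀ {x T} → ∣ x ∣≤ T → ∀ n → ∣ expSum x n ∣≤ expSum T n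
  expSum-abs x≤T zero    = abs≤-nonneg (≤-reflexive refl)
  expSum-abs x≤T (suc n) = abs≤-+ (expSum-abs x≤T n) (expTerm-abs x≤T n)

  expSum-mono : ∀ {x} → 0# ≤ x → ∀ {m n} → m ℕ.≤ n → 0# ≤ expSum x n - expSum x m
  expSum-mono {x} 0≤x m≤n = go (ℕₚ.≤⇒≤′ m≤n)
    where
    go : ∀ {m n} → m ℕ.≤′ n → 0# ≤ expSum x n - expSum x m
    go (ℕ.≤′-reflexive ≡.refl) = ≤-reflexive (sym (-‿inverseʳ _))
    go {m} {suc n} (ℕ.≤′-step m≤n)  = ≤-resp refl
      (solve 3 (λ a b c → (a :- b) :+ c := a :+ c :- b) refl (expSum x n) (expSum x m) (expTerm x n))
      (nonneg-+ (go m≤n) (expTerm-nonneg 0≤x n))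

  expSum≤exp : ∀ {x} → 0# ≤ x → ∀ n → 0# ≤ exp x - expSum x n
  expSum≤exp {x} 0≤x n = limit-nonneg n (λ m n≤m → expSum-mono 0≤x n≤m)
    (converges-+ (exp-converges x) (converges-const (- expSum x n)))

  -- The term is the last one of a partial sum whose other terms add up to something nonnegative,
  -- and partial sums stay below the limit.
  expTerm≤exp : ∀ {x} → 0# ≤ x → ∀ k → 0# ≤ exp x - expTerm x k
  expTerm≤exp {x} 0≤x k = ≤-resp refl
    (solve 3 (λ e s t → (e :- (s :+ t)) :+ s := e :- t) refl (exp x) (expSum x k) (expTerm x k))
    (nonneg-+ (expSum≤exp 0≤x (suc k)) (abs≤⇒nonneg (expSum-abs (abs≤-nonneg 0≤x) k)))

  expSum-abs-exp : ∀ {x T} → ∣ x ∣≤ T → ∀ n → ∣ expSum x n ∣≤ exp T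
  expSum-abs-exp x≤T n = abs≤-weaken (expSum≤exp (abs≤⇒nonneg x≤T) n) (expSum-abs x≤T n)

  exp-abs : ∀ {x T} → ∣ x ∣≤ T → ∣ exp x ∣≤ exp T
  exp-abs x≤T = limit-abs (expSum-abs-exp x≤T) (exp-converges _)

  remainder : (F f : Carrier → Carrier) → Carrier → Carrier → Carrier
  remainder F f v t = F v - F t - f t * (v - t)

  module _ {T v t : Carrier} (v≤T : ∣ v ∣≤ T) (t≤T : ∣ t ∣≤ T) where
    private
      0≤T : 0# ≤ T
      0≤T = abs≤⇒nonneg v≤T

      h² : Carrier
      h² = (v - t) * (v - t)

      0≤h² : 0# ≤ h²
      0≤h² = square-nonneg (v - t)

    -- A bound on `[-T, T]` for the second derivative of `xᵏ⁺¹ / (k + 1)!`, hence 0 at `k = 0`.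
    -- Taylor's factor ½ is given up.
    remainderBound : ℕ → Carrier
    remainderBound zero    = 0#
    remainderBound (suc k) = expTerm T k

    remainderBound-suc : ∀ k → T * remainderBound k ≈ (k · 1#) * expTerm T k
    remainderBound-suc zero    = trans (zeroʳ T) (sym (zeroˡ _))
    remainderBound-suc (suc k) = *-expTerm T k

    expTermRemainder : ℕ → Carrier
    expTermRemainder k = remainder (λ x → expTerm x (suc k)) (λ x → expTerm x k) v t

    -- This recurrence carries the induction for the remainder bound. Multiplied by `k + 2`, its
    -- left side differs from `v * expTermRemainder k` by `(v * d - n * b) * (v - t)`, and
    -- `n * b ≈ t * d` turns this into `d * h²`.
    expTermRemainder-suc : ∀ k →
      expTermRemainder (suc k) ≈ 1/ suc (suc k) * (v * expTermRemainder k + expTerm t k * h²)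
    expTermRemainder-suc k = begin
      expTerm v (suc (suc k)) - expTerm t (suc (suc k)) - b * (v - t)
        ≈⟨ +-congʳ (+-cong (expTerm-suc v (suc k)) (-‿cong (expTerm-suc t (suc k)))) ⟩
      a * (v * i) - b * (t * i) - b * (v - t)
        -- Inserting `1# ≈ (1# + n) * i` gives all terms the common factor `i` and produces `n * b`,
        -- ready for `*-expTerm`.
        ≈⟨ +-congˡ (-‿cong (trans (*-congˡ (sym (*-identityʳ _)))
             (trans (*-congˡ (*-congˡ (sym (*-inverseʳ (0<n·1 (suc (suc k)))))))
               (solve 4 (λ b h n i → b :* (h :* ((con (ℤ.+ 1) :+ n) :* i)) := n :* b :* (h :* i) :+ b :* h :* i)
                 refl b (v - t) n i)))) ⟩
      a * (v * i) - b * (t * i) - (n * b * ((v - t) * i) + b * (v - t) * i)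
        ≈⟨ +-congˡ (-‿cong (+-congʳ (*-congʳ (sym (*-expTerm t k))))) ⟩
      a * (v * i) - b * (t * i) - (t * d * ((v - t) * i) + b * (v - t) * i)
        ≈⟨ solve 6 (λ a b d v t i →
             a :* (v :* i) :- b :* (t :* i) :- (t :* d :* ((v :- t) :* i) :+ b :* (v :- t) :* i) :=
             i :* (v :* (a :- b :- d :* (v :- t)) :+ d :* ((v :- t) :* (v :- t)))) refl a b d v t i ⟩
      i * (v * expTermRemainder k + d * h²) ∎
      where
      a = expTerm v (suc k)
      b = expTerm t (suc k)
      d = expTerm t k
      i = 1/ suc (suc k)
      n = suc k · 1#

    expTermRemainder-abs : ∀ k → ∣ expTermRemainder k ∣≤ (remainderBound k * h²)
    expTermRemainder-abs zero    = abs≤-cong (sym (begin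
      expTerm v 1 - expTerm t 1 - expTerm t 0 * (v - t)
        ≈⟨ +-cong (+-cong (expTerm-one v) (-‿cong (expTerm-one t)))
             (-‿cong (*-congʳ (expTerm-zero t))) ⟩
      v - t - 1# * (v - t)
        ≈⟨ solve 2 (λ v t → v :- t :- con (ℤ.+ 1) :* (v :- t) := con (ℤ.+ 0)) refl v t ⟩
      0# ∎)) (sym (zeroˡ _)) (abs≤-0 (≤-reflexive refl))
    expTermRemainder-abs (suc k) = abs≤-cong (sym (expTermRemainder-suc k)) refl
      (abs≤-weaken
        (≤-resp refl slack
          (nonneg-* (nonneg-* (1/-nonneg (suc (suc k))) (expTerm-nonneg 0≤T k)) 0≤h²))
        (abs≤-* (abs≤-nonneg (1/-nonneg (suc (suc k)))) (abs≤-+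
          (abs≤-* v≤T (expTermRemainder-abs k))
          (abs≤-* (expTerm-abs t≤T k) (abs≤-nonneg 0≤h²)))))
      where
      i = 1/ suc (suc k)
      e = expTerm T k
      -- Since `T * remainderBound k ≈ k * e`, the recurrence yields the bound
      -- `(k + 1) * i * e * h²` with `i = 1 / (k + 2)`; it falls short of `e * h²` by one share
      -- `i * e * h²`.
      slack : i * e * h² ≈ e * h² - i * (T * (remainderBound k * h²) + e * h²)
      slack = sym (begin
        e * h² - i * (T * (remainderBound k * h²) + e * h²)
          ≈⟨ solve 5 (λ e s i T r → e :* s :- i :* (T :* (r :* s) :+ e :* s) :=
               con (ℤ.+ 1) :* (e :* s) :- i :* (T :* r :* s :+ e :* s)) refl e h² i T _ ⟩
        1# * (e * h²) - i * (T * remainderBound k * h² + e * h²)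
          ≈⟨ +-cong (*-congʳ (sym (*-inverseʳ (0<n·1 (suc (suc k))))))
               (-‿cong (*-congˡ (+-congʳ (*-congʳ (remainderBound-suc k))))) ⟩
        (1# + (1# + k · 1#)) * i * (e * h²) - i * ((k · 1#) * e * h² + e * h²)
          ≈⟨ solve 4 (λ n i e s → (con (ℤ.+ 1) :+ (con (ℤ.+ 1) :+ n)) :* i :* (e :* s) :-
                 i :* (n :* e :* s :+ e :* s) := i :* e :* s) refl (k · 1#) i e h² ⟩
        i * e * h² ∎)

    expSumRemainder-zero : remainder (λ x → expSum x 1) (λ x → expSum x 0) v t ≈ 0#
    expSumRemainder-zero = trans
      (+-congʳ (+-cong (trans (+-identityˡ _) (expTerm-zero v))
        (-‿cong (trans (+-identityˡ _) (expTerm-zero t)))))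
      (solve 1 (λ h → con (ℤ.+ 1) :- con (ℤ.+ 1) :- con (ℤ.+ 0) :* h := con (ℤ.+ 0)) refl (v - t))

    -- The bounds of the single terms add up: `remainderBound 0`, ..., `remainderBound n` sum to
    -- `expSum T n`, as the first of them is 0. The constant term of the series has remainder 0.
    expSumRemainder-abs : ∀ n →
      ∣ remainder (λ x → expSum x (suc (suc n))) (λ x → expSum x (suc n)) v t ∣≤ (expSum T n * h²)
    expSumRemainder-abs zero = abs≤-cong
      (trans (sym (+-identityˡ _)) (trans (+-congʳ (sym expSumRemainder-zero)) step))
      refl (expTermRemainder-abs 0)
      where
      step = solve 7 (λ a b c p q r h →
        (a :- b :- c :* h) :+ (p :- q :- r :* h) := (a :+ p) :- (b :+ q) :- (c :+ r) :* h) refl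
        (expSum v 1) (expSum t 1) (expSum t 0) (expTerm v 1) (expTerm t 1) (expTerm t 0) (v - t)
    expSumRemainder-abs (suc n) = abs≤-cong
      (solve 7 (λ a b c p q r h →
        (a :- b :- c :* h) :+ (p :- q :- r :* h) := (a :+ p) :- (b :+ q) :- (c :+ r) :* h) refl
        (expSum v (suc (suc n))) (expSum t (suc (suc n))) (expSum t (suc n))
        (expTerm v (suc (suc n))) (expTerm t (suc (suc n))) (expTerm t (suc n)) (v - t))
      (sym (distribʳ h² (expSum T n) (expTerm T n)))
      (abs≤-+ (expSumRemainder-abs n) (expTermRemainder-abs (suc n)))

    expSumRemainder-abs-exp : ∀ n →
      ∣ remainder (λ x → expSum x (suc n)) (λ x → expSum x n) v t ∣≤ (exp T * h²)
    expSumRemainder-abs-exp zero    = abs≤-cong (sym expSumRemainder-zero) refl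
      (abs≤-0 (nonneg-* (abs≤⇒nonneg (exp-abs v≤T)) 0≤h²))
    expSumRemainder-abs-exp (suc n) = abs≤-weaken (≤-resp refl
        (solve 3 (λ a b s → (a :- b) :* s := a :* s :- b :* s) refl (exp T) (expSum T n) h²)
        (nonneg-* (expSum≤exp 0≤T n) 0≤h²)) (expSumRemainder-abs n)

    expRemainder-abs : ∣ remainder exp exp v t ∣≤ (exp T * h²)
    expRemainder-abs = limit-abs (λ n → expSumRemainder-abs-exp (suc n))
      (converges-cong (λ n → +-congˡ (-‿cong (*-comm _ _))) (+-congˡ (-‿cong (*-comm _ _)))
        (converges-+
          (converges-+ (converges-suc (converges-suc (exp-converges v)))
            (converges-neg (converges-suc (converges-suc (exp-converges t)))))
          (converges-neg (converges-* (v - t) (converges-suc (exp-converges t))))))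

  -- By antisymmetry it is enough that neither `x` nor `- x` is positive: a positive number would
  -- exceed some `½ ^ j * b`.
  geometric-bound⇒≈0 : ∀ {x b} → (∀ j → ∣ x ∣≤ (½ ^ j * b)) → x ≈ 0#
  geometric-bound⇒≈0 {x} {b} x≤½ʲb = ≤-antisym
    (λ 0<x → no-gap 0<x (λ j → proj₁ (x≤½ʲb j)))
    (λ x<0 → no-gap (neg-<0 x<0) (λ j → proj₁ (abs≤-neg (x≤½ʲb j))))
    where
    0≤b : 0# ≤ b
    0≤b = ≤-resp refl (*-identityˡ b) (abs≤⇒nonneg (x≤½ʲb 0))
    0<1+b : 0# < 1# + b
    0<1+b = pos+nonneg 0<1 0≤b
    -- Borrows the halving sequence `β j ≈ ½ ^ j * (1# + b)` and its smallness. At `0#` the term of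
    -- index 2 vanishes, so any positive starting value is allowed; `1# + b` is positive even if `b`
    -- is 0.
    open CauchyBound 0# 1 (abs-0 (0<n·1 1)) (1# + b) (abs-cong (sym (expTerm-zeroˡ 1)) (abs-0 0<1+b))
      using (β; 0<β; β-small)
    ½^-nonneg : ∀ j → 0# ≤ ½ ^ j
    ½^-nonneg zero    = <⇒≤ 0<1
    ½^-nonneg (suc j) = nonneg-* (<⇒≤ 0<½) (½^-nonneg j)
    β≈ : ∀ j → β j ≈ ½ ^ j * (1# + b)
    β≈ zero    = sym (*-identityˡ _)
    β≈ (suc j) = trans (*-congʳ (β≈ j))
      (solve 3 (λ p b s → p :* b :* s := s :* p :* b) refl (½ ^ j) (1# + b) ½)
    gap : ∀ {p B y} → B ≈ p * (1# + b) → 0# ≤ p → 0# ≤ B → 0# ≤ p * b - y → y ≤ B + B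
    gap {p} {B} {y} B≈ 0≤p 0≤B y≤pb = nonneg⇒≤ (≤-resp refl e (nonneg-+ (nonneg-+ y≤pb 0≤p) 0≤B))
      where
      e : (p * b - y) + p + B ≈ B + B - y
      e = begin
        (p * b - y) + p + B
          ≈⟨ solve 4 (λ p b B y → (p :* b :- y) :+ p :+ B := p :* (con (ℤ.+ 1) :+ b) :+ B :- y) refl
               p b B y ⟩
        p * (1# + b) + B - y  ≈⟨ +-congʳ (+-congʳ B≈) ⟨
        B + B - y             ∎
    no-gap : ∀ {y} → 0# < y → (∀ j → 0# ≤ ½ ^ j * b - y) → ⊥
    no-gap 0<y y≤½ʲb = let j , 2β<y = β-small _ 0<y in
      gap (β≈ j) (½^-nonneg j) (<⇒≤ (0<β j)) (y≤½ʲb j) 2β<y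

-- Differentiation with quadratic remainders on [-T, T]

module SmoothFunctions {c ℓ₁ ℓ₂ ℓ₃ : Level} (R : RealNumbers c ℓ₁ ℓ₂ ℓ₃)
  (T : RealNumbers.Carrier R) (0≤T : RealNumbers._≤_ R (RealNumbers.0# R) T) where
  open RealNumbers R
  open OrderedField R
  open RealExponential R
  open Inequalities R
  open ExponentialBounds R
  open IntegerCoefficients commutativeRing using (solve; con; _:=_; _:+_; _:*_; _:-_; :-_)
  open SetoidReasoning setoid

  -- f is the derivative of F on [-T, T].  The quadratic error bound avoids
  -- limits and, with the bounds on F and f, is preserved by products.
  record Smooth (F f : Carrier → Carrier) : Set (c ⊔ ℓ₃) where
    field
      valueBound      : Carrier
      derivativeBound : Carrier
      errorBound      : Carrier
      value-abs       : ∀ {x} → ∣ x ∣≤ T → ∣ F x ∣≤ valueBound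
      derivative-abs  : ∀ {x} → ∣ x ∣≤ T → ∣ f x ∣≤ derivativeBound
      errorBound-nonneg : 0# ≤ errorBound
      error-abs       : ∀ {v t} → ∣ v ∣≤ T → ∣ t ∣≤ T →
        ∣ remainder F f v t ∣≤ (errorBound * ((v - t) * (v - t)))

    valueBound-nonneg : 0# ≤ valueBound
    valueBound-nonneg = abs≤⇒nonneg (value-abs (abs≤-0 0≤T))

    derivativeBound-nonneg : 0# ≤ derivativeBound
    derivativeBound-nonneg = abs≤⇒nonneg (derivative-abs (abs≤-0 0≤T))

    -- A bare function need not respect `_≈_`, but here the remainder bound vanishes for `v ≈ t` and
    -- forces it. This is how the end points of a partition, known only up to `_≈_`, are replaced by
    -- `0#` and `T`.
    value-cong : ∀ {v t} → ∣ v ∣≤ T → ∣ t ∣≤ T → v ≈ t → F v ≈ F t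
    value-cong {v} {t} v≤T t≤T v≈t = begin
      F v
        ≈⟨ solve 3 (λ a b d → a := (a :- b :- d) :+ (b :+ d)) refl (F v) (F t) _ ⟩
      remainder F f v t + (F t + f t * (v - t))
        ≈⟨ +-cong (abs≤-0⇒≈0 (abs≤-cong refl bound≈0 (error-abs v≤T t≤T))) (+-congˡ (*-congˡ v-t≈0)) ⟩
      0# + (F t + f t * 0#)
        ≈⟨ solve 2 (λ b f → con (ℤ.+ 0) :+ (b :+ f :* con (ℤ.+ 0)) := b) refl (F t) (f t) ⟩
      F t ∎
      where
      v-t≈0 : v - t ≈ 0#
      v-t≈0 = trans (+-congʳ v≈t) (-‿inverseʳ t)
      bound≈0 : errorBound * ((v - t) * (v - t)) ≈ 0#
      bound≈0 = trans (*-congˡ (trans (*-congʳ v-t≈0) (zeroˡ _))) (zeroʳ _)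

  smooth-cong : ∀ {F G f g} → (∀ x → F x ≈ G x) → (∀ x → f x ≈ g x) →
    Smooth F f → Smooth G g
  smooth-cong F≈G f≈g F′ = record
    { valueBound        = valueBound
    ; derivativeBound   = derivativeBound
    ; errorBound        = errorBound
    ; value-abs         = λ x≤T → abs≤-cong (F≈G _) refl (value-abs x≤T)
    ; derivative-abs    = λ x≤T → abs≤-cong (f≈g _) refl (derivative-abs x≤T)
    ; errorBound-nonneg = errorBound-nonneg
    ; error-abs         = λ v≤T t≤T → abs≤-cong
        (+-cong (+-cong (F≈G _) (-‿cong (F≈G _))) (-‿cong (*-congʳ (f≈g _)))) refl
        (error-abs v≤T t≤T)
    }
    where open Smooth F′

  smooth-const : ∀ a → Smooth (λ _ → a) (λ _ → 0#)
  smooth-const a = record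
    { valueBound        = proj₁ (abs≤-exists a)
    ; derivativeBound   = 0#
    ; errorBound        = 0#
    ; value-abs         = λ _ → proj₂ (abs≤-exists a)
    ; derivative-abs    = λ _ → abs≤-nonneg (≤-reflexive refl)
    ; errorBound-nonneg = ≤-reflexive refl
    ; error-abs         = λ {v} {t} _ _ → abs≤-cong
        (solve 2 (λ a h → con (ℤ.+ 0) := a :- a :- con (ℤ.+ 0) :* h) refl a (v - t))
        (sym (zeroˡ _)) (abs≤-nonneg (≤-reflexive refl))
    }

  smooth-+ : ∀ {F G f g} → Smooth F f → Smooth G g →
    Smooth (λ x → F x + G x) (λ x → f x + g x)
  smooth-+ {F = F} {G} {f} {g} F′ G′ = record
    { valueBound        = F′.valueBound + G′.valueBound
    ; derivativeBound   = F′.derivativeBound + G′.derivativeBound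
    ; errorBound        = F′.errorBound + G′.errorBound
    ; value-abs         = λ x≤T → abs≤-+ (F′.value-abs x≤T) (G′.value-abs x≤T)
    ; derivative-abs    = λ x≤T → abs≤-+ (F′.derivative-abs x≤T) (G′.derivative-abs x≤T)
    ; errorBound-nonneg = nonneg-+ F′.errorBound-nonneg G′.errorBound-nonneg
    ; error-abs         = λ {v} {t} v≤T t≤T → abs≤-cong
        (solve 7 (λ a b c p q r h →
          (a :- b :- c :* h) :+ (p :- q :- r :* h) := (a :+ p) :- (b :+ q) :- (c :+ r) :* h) refl
          (F v) (F t) (f t) (G v) (G t) (g t) (v - t))
        (sym (distribʳ _ F′.errorBound G′.errorBound))
        (abs≤-+ (F′.error-abs v≤T t≤T) (G′.error-abs v≤T t≤T))
    }
    where
    module F′ = Smooth F′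
    module G′ = Smooth G′

  -- With `h = v - t`, the remainder of the product is the remainder of `F` times `G v`, plus `F t`
  -- times that of `G`, plus `f t * h * (G v - G t)`. Expanding `G v - G t` splits the last part
  -- into `f t * g t * h²` and a cubic term, made quadratic by bounding `h` by `T + T`.
  smooth-* : ∀ {F G f g} → Smooth F f → Smooth G g →
    Smooth (λ x → F x * G x) (λ x → f x * G x + F x * g x)
  smooth-* {F} {G} {f} {g} F′ G′ = record
    { valueBound        = F′.valueBound * G′.valueBound
    ; derivativeBound   = F′.derivativeBound * G′.valueBound + F′.valueBound * G′.derivativeBound
    ; errorBound        =
        F′.errorBound * G′.valueBound + F′.valueBound * G′.errorBound +
        (F′.derivativeBound * G′.derivativeBound + F′.derivativeBound * ((T + T) * G′.errorBound))
    ; value-abs         = λ x≤T → abs≤-* (F′.value-abs x≤T) (G′.value-abs x≤T)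
    ; derivative-abs    = λ x≤T → abs≤-+ (abs≤-* (F′.derivative-abs x≤T) (G′.value-abs x≤T))
                                          (abs≤-* (F′.value-abs x≤T) (G′.derivative-abs x≤T))
    ; errorBound-nonneg = nonneg-+
        (nonneg-+ (nonneg-* F′.errorBound-nonneg G′.valueBound-nonneg)
                  (nonneg-* F′.valueBound-nonneg G′.errorBound-nonneg))
        (nonneg-+ (nonneg-* F′.derivativeBound-nonneg G′.derivativeBound-nonneg)
                  (nonneg-* F′.derivativeBound-nonneg
                    (nonneg-* (nonneg-+ 0≤T 0≤T) G′.errorBound-nonneg)))
    ; error-abs         = λ {v} {t} v≤T t≤T → abs≤-cong
        (solve 7 (λ a b c p q r h →
          (a :- b :- c :* h) :* p :+ b :* (p :- q :- r :* h) :+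
            (c :* r :* (h :* h) :+ c :* (h :* (p :- q :- r :* h))) :=
          a :* p :- b :* q :- (c :* q :+ b :* r) :* h) refl
          (F v) (F t) (f t) (G v) (G t) (g t) (v - t))
        (solve 8 (λ kf bg bf kg df dg T s →
          kf :* s :* bg :+ bf :* (kg :* s) :+ (df :* dg :* s :+ df :* ((T :+ T) :* (kg :* s))) :=
          (kf :* bg :+ bf :* kg :+ (df :* dg :+ df :* ((T :+ T) :* kg))) :* s) refl
          F′.errorBound G′.valueBound F′.valueBound G′.errorBound
          F′.derivativeBound G′.derivativeBound T ((v - t) * (v - t)))
        (abs≤-+ (abs≤-+ (abs≤-* (F′.error-abs v≤T t≤T) (G′.value-abs v≤T))
                        (abs≤-* (F′.value-abs t≤T) (G′.error-abs v≤T t≤T)))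
          (abs≤-+ (abs≤-* (abs≤-* (F′.derivative-abs t≤T) (G′.derivative-abs t≤T))
                          (abs≤-nonneg (square-nonneg (v - t))))
                  (abs≤-* (F′.derivative-abs t≤T)
                    (abs≤-* (abs≤-+ v≤T (abs≤-neg t≤T)) (G′.error-abs v≤T t≤T)))))
    }
    where
    module F′ = Smooth F′
    module G′ = Smooth G′

  smooth-scale : ∀ k {F f} → Smooth F f → Smooth (λ x → k * F x) (λ x → k * f x)
  smooth-scale k F′ = smooth-cong (λ _ → refl)
    (λ _ → trans (+-congʳ (zeroˡ _)) (+-identityˡ _)) (smooth-* (smooth-const k) F′)

  smooth-expSum : ∀ n → Smooth (λ x → expSum x (suc n)) (λ x → expSum x n)
  smooth-expSum n = record
    { valueBound        = exp T
    ; derivativeBound   = exp T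
    ; errorBound        = exp T
    ; value-abs         = λ x≤T → expSum-abs-exp x≤T (suc n)
    ; derivative-abs    = λ x≤T → expSum-abs-exp x≤T n
    ; errorBound-nonneg = abs≤⇒nonneg (exp-abs (abs≤-0 0≤T))
    ; error-abs         = λ v≤T t≤T → expSumRemainder-abs-exp v≤T t≤T n
    }

  smooth-exp : Smooth exp exp
  smooth-exp = record
    { valueBound        = exp T
    ; derivativeBound   = exp T
    ; errorBound        = exp T
    ; value-abs         = exp-abs
    ; derivative-abs    = exp-abs
    ; errorBound-nonneg = abs≤⇒nonneg (exp-abs (abs≤-0 0≤T))
    ; error-abs         = expRemainder-abs
    }

  -- Reflection preserves `[-T, T]` and `(v - t)²`, so the constants of `exp` carry over.
  smooth-exp-neg : Smooth (λ x → exp (- x)) (λ x → - exp (- x))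
  smooth-exp-neg = record
    { valueBound        = exp T
    ; derivativeBound   = exp T
    ; errorBound        = exp T
    ; value-abs         = λ x≤T → exp-abs (abs≤-neg x≤T)
    ; derivative-abs    = λ x≤T → abs≤-neg (exp-abs (abs≤-neg x≤T))
    ; errorBound-nonneg = abs≤⇒nonneg (exp-abs (abs≤-0 0≤T))
    ; error-abs         = λ {v} {t} v≤T t≤T → abs≤-cong
        (solve 4 (λ a b v t → a :- b :- b :* (:- v :- :- t) := a :- b :- (:- b) :* (v :- t)) refl
          (exp (- v)) (exp (- t)) v t)
        (*-congˡ (solve 2 (λ v t → (:- v :- :- t) :* (:- v :- :- t) := (v :- t) :* (v :- t)) refl v t))
        (expRemainder-abs (abs≤-neg v≤T) (abs≤-neg t≤T))
    }

  -- With derivative 0 the remainder is the increment itself. The constant of its quadratic bound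
  -- can be halved any number of times, which leaves only an increment of 0.
  constant-of-zero-derivative : ∀ {F} → Smooth F (λ _ → 0#) →
    ∀ {v t} → ∣ v ∣≤ T → ∣ t ∣≤ T → F v ≈ F t
  constant-of-zero-derivative {F} F′ {v} {t} v≤T t≤T = begin
    F v                ≈⟨ solve 2 (λ a b → a := a :- b :+ b) refl (F v) (F t) ⟩
    F v - F t + F t    ≈⟨ +-congʳ (geometric-bound⇒≈0 λ j →
                            abs≤-cong refl (*-assoc _ _ _) (increment j v≤T t≤T)) ⟩
    0# + F t           ≈⟨ +-identityˡ _ ⟩
    F t                ∎
    where
    open Smooth F′
    -- Inserting the midpoint halves the constant of a quadratic bound.
    increment : ∀ j {v t} → ∣ v ∣≤ T → ∣ t ∣≤ T →
      ∣ F v - F t ∣≤ (½ ^ j * errorBound * ((v - t) * (v - t)))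
    increment zero {v} {t} v≤T t≤T = abs≤-cong
      (solve 3 (λ a b h → a :- b :- con (ℤ.+ 0) :* h := a :- b) refl (F v) (F t) (v - t))
      (*-congʳ (sym (*-identityˡ _))) (error-abs v≤T t≤T)
    increment (suc j) {v} {t} v≤T t≤T = abs≤-cong
      (solve 3 (λ a m b → (a :- m) :+ (m :- b) := a :- b) refl (F v) (F m) (F t))
      (begin
        K * ((v - m) * (v - m)) + K * ((m - t) * (m - t))
          ≈⟨ +-cong (*-congˡ (*-cong v-m v-m)) (*-congˡ (*-cong m-t m-t)) ⟩
        K * ((v - t) * ½ * ((v - t) * ½)) + K * ((v - t) * ½ * ((v - t) * ½))
          ≈⟨ solve 4 (λ p e h s → p :* e :* (h :* s :* (h :* s)) :+ p :* e :* (h :* s :* (h :* s)) :=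
               (s :+ s) :* (s :* p :* e :* (h :* h))) refl (½ ^ j) errorBound (v - t) ½ ⟩
        (½ + ½) * (½ * ½ ^ j * errorBound * ((v - t) * (v - t)))
          ≈⟨ trans (*-congʳ ½+½≈1) (*-identityˡ _) ⟩
        ½ * ½ ^ j * errorBound * ((v - t) * (v - t)) ∎)
      (abs≤-+ (increment j v≤T m≤T) (increment j m≤T t≤T))
      where
      K = ½ ^ j * errorBound
      m = (v + t) * ½
      m≤T : ∣ m ∣≤ T
      m≤T = abs≤-cong refl (w+w*½ T)
        (abs≤-* (abs≤-+ v≤T t≤T) (abs≤-nonneg (<⇒≤ 0<½)))
      v-m : v - m ≈ (v - t) * ½
      v-m = trans (+-congʳ (sym (½+½-split v)))
        (solve 3 (λ v t s → (v :* s :+ v :* s) :- (v :+ t) :* s := (v :- t) :* s) refl v t ½)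
      m-t : m - t ≈ (v - t) * ½
      m-t = trans (+-congˡ (-‿cong (sym (½+½-split t))))
        (solve 3 (λ v t s → (v :+ t) :* s :- (t :* s :+ t :* s) := (v :- t) :* s) refl v t ½)

  exp-neg-inverse : exp (- T) * exp T ≈ 1#
  exp-neg-inverse = begin
    exp (- T) * exp T
      ≈⟨ constant-of-zero-derivative
           (smooth-cong (λ _ → refl) (λ x → solve 2 (λ a b → (:- a) :* b :+ a :* b := con (ℤ.+ 0)) refl
              (exp (- x)) (exp x)) (smooth-* smooth-exp-neg smooth-exp))
           (abs≤-nonneg 0≤T) (abs≤-0 0≤T) ⟩
    exp (- 0#) * exp 0#
      ≈⟨ *-cong (trans (exp-cong -0#≈0#) exp-0) exp-0 ⟩
    1# * 1#  ≈⟨ *-identityˡ 1# ⟩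
    1#       ∎

  -- A negative `exp (- T)` times the positive `exp T` would make `1#` negative.
  exp-neg-nonneg : 0# ≤ exp (- T)
  exp-neg-nonneg E<0 = <-asym 0<1 (<-respˡ-≈ e (<-respʳ-≈ (zeroˡ _) (*-monoʳ-< 0<exp E<0)))
    where
    0<exp : 0# < exp T
    0<exp = <-≤-trans 0<1 (nonneg⇒≤
      (≤-resp refl (+-congˡ (-‿cong (expTerm-zero T))) (expTerm≤exp 0≤T 0)))
    e = exp-neg-inverse

-- Riemann sums of a derivative

module FundamentalTheorem {c ℓ₁ ℓ₂ ℓ₃ : Level} (R : RealNumbers c ℓ₁ ℓ₂ ℓ₃)
  (T : RealNumbers.Carrier R) (0≤T : RealNumbers._≤_ R (RealNumbers.0# R) T) where
  open RealNumbers R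
  open OrderedField R
  open Inequalities R
  open ExponentialBounds R
  open SmoothFunctions R T 0≤T
  open FiniteSum rawRing
  open Integration R using (TaggedPartition; Mesh<_)
  open IntegerCoefficients commutativeRing using (solve; con; _:=_; _:+_; _:*_; _:-_; :-_)

  module _ {F f : Carrier → Carrier} (F′ : Smooth F f) (P : TaggedPartition 0# T)
    {δ : Carrier} (mesh : (Mesh< δ) P) where
    open Smooth F′
    open TaggedPartition P

    point-step : ∀ i → i ℕ.< size → point i ≤ point (suc i)
    point-step i i<n = ≤-trans (point≤tag i i<n) (tag≤point i i<n)

    0≤point : ∀ i → i ℕ.≤ size → 0# ≤ point i
    0≤point zero    _   = ≤-reflexive (sym start)
    0≤point (suc i) i<n = ≤-trans (0≤point i (ℕₚ.<⇒≤ i<n)) (point-step i i<n)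

    point≤T : ∀ i → i ℕ.≤ size → point i ≤ T
    point≤T i i≤n = go (ℕₚ.≤⇒≤‴ i≤n)
      where
      -- The induction runs downward from the last point, which is the one known to equal `T`.
      go : ∀ {i} → i ℕ.≤‴ size → point i ≤ T
      go ℕ.≤‴-refl           = ≤-reflexive end
      go (ℕ.≤‴-step i<n) = ≤-trans (point-step _ (ℕₚ.≤‴⇒≤ i<n)) (go i<n)

    within : ∀ {x} → 0# ≤ x → x ≤ T → ∣ x ∣≤ T
    within 0≤x x≤T = ≤⇒nonneg x≤T , nonneg-+ 0≤T 0≤x

    point-abs : ∀ i → i ℕ.≤ size → ∣ point i ∣≤ T
    point-abs i i≤n = within (0≤point i i≤n) (point≤T i i≤n)

    tag-abs : ∀ i → i ℕ.< size → ∣ tag i ∣≤ T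
    tag-abs i i<n = within (≤-trans (0≤point i (ℕₚ.<⇒≤ i<n)) (point≤tag i i<n))
      (≤-trans (tag≤point i i<n) (point≤T (suc i) i<n))

    -- The error for the piece [u, v] with tag t is the difference of the
    -- remainders of F at t, and (v - t)² + (t - u)² ≤ (v - u)² ≤ δ (v - u).
    piece-error : ∀ i → i ℕ.< size →
      ∣ f (tag i) * width i - (F (point (suc i)) - F (point i)) ∣≤ (errorBound * δ * width i)
    piece-error i i<n = abs≤-cong
      (solve 7 (λ a b c f v t u →
         :- (a :- b :- f :* (v :- t)) :+ (c :- b :- f :* (u :- t)) := f :* (v :- u) :- (a :- c)) refl
         (F v) (F t) (F u) (f t) v t u)
      refl
      (abs≤-weaken (≤-resp refl
          (solve 5 (λ k d v t u →
             k :* ((d :- (v :- u)) :* (v :- u) :+ ((v :- t) :* (t :- u) :+ (v :- t) :* (t :- u))) :=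
             k :* d :* (v :- u) :- (k :* ((v :- t) :* (v :- t)) :+ k :* ((u :- t) :* (u :- t)))) refl
             errorBound δ v t u)
          (nonneg-* errorBound-nonneg (nonneg-+
            (nonneg-* (<⇒≤ (<⇒pos (mesh i i<n))) (≤⇒nonneg (point-step i i<n)))
            (nonneg-+ 0≤cross 0≤cross))))
        (abs≤-+ (abs≤-neg (error-abs (point-abs (suc i) i<n) (tag-abs i i<n)))
                (error-abs (point-abs i (ℕₚ.<⇒≤ i<n)) (tag-abs i i<n))))
      where
      u = point i
      v = point (suc i)
      t = tag i
      0≤cross : 0# ≤ (v - t) * (t - u)
      0≤cross = nonneg-* (≤⇒nonneg (tag≤point i i<n)) (≤⇒nonneg (point≤tag i i<n))

    -- The errors of the pieces add up, while the increments of `F` and the widths both telescope.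
    riemannSum-error : ∀ m → m ℕ.≤ size →
      ∣ ∑< m (λ i → f (tag i) * width i) - (F (point m) - F (point 0)) ∣≤
        (errorBound * δ * (point m - point 0))
    riemannSum-error zero    _   = abs≤-cong
      (solve 1 (λ a → con (ℤ.+ 0) := con (ℤ.+ 0) :- (a :- a)) refl (F (point 0)))
      (solve 2 (λ k a → con (ℤ.+ 0) := k :* (a :- a)) refl (errorBound * δ) (point 0))
      (abs≤-nonneg (≤-reflexive refl))
    riemannSum-error (suc m) m<n = abs≤-cong
      (solve 5 (λ s p a b c → (s :- (b :- c)) :+ (p :- (a :- b)) := s :+ p :- (a :- c)) refl
        (∑< m (λ i → f (tag i) * width i)) (f (tag m) * width m)
        (F (point (suc m))) (F (point m)) (F (point 0)))
      (solve 4 (λ k a b c → k :* (b :- c) :+ k :* (a :- b) := k :* (a :- c)) refl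
        (errorBound * δ) (point (suc m)) (point m) (point 0))
      (abs≤-+ (riemannSum-error m (ℕₚ.<⇒≤ m<n)) (piece-error m m<n))

    fundamentalTheorem :
      ∣ ∑< size (λ i → f (tag i) * width i) - (F T - F 0#) ∣≤ (errorBound * δ * T)
    fundamentalTheorem = abs≤-cong
      (+-congˡ (-‿cong (+-cong
        (value-cong (point-abs size ℕₚ.≤-refl) (abs≤-nonneg 0≤T) end)
        (-‿cong (value-cong (point-abs 0 ℕ.z≤n) (abs≤-0 0≤T) start)))))
      (*-congˡ (trans (+-cong end (-‿cong start)) (trans (+-congˡ -0#≈0#) (+-identityʳ T))))
      (riemannSum-error size ℕₚ.≤-refl)

-- Decay of e⁻ᵀ Tᵏ / k! at infinity

module Decay {c ℓ₁ ℓ₂ ℓ₃ : Level} (R : RealNumbers c ℓ₁ ℓ₂ ℓ₃) where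
  open RealNumbers R
  open OrderedField R
  open RealExponential R
  open Inequalities R
  open ExponentialBounds R
  open IntegerCoefficients commutativeRing using (solve; con; _:=_; _:*_; _:-_; :-_)
  open SetoidReasoning setoid

  -- Thresholds are required to be nonnegative so that the sum of two of them dominates both.
  Vanishes : (Carrier → Carrier) → Set (c ⊔ ℓ₃)
  Vanishes F = ∀ ε → 0# < ε → ∃[ T₀ ] 0# ≤ T₀ × (∀ T → T₀ ≤ T → ∣ F T ∣< ε)

  vanishes-cong : ∀ {F G} → (∀ T → F T ≈ G T) → Vanishes F → Vanishes G
  vanishes-cong F≈G F→0 ε 0<ε = let T₀ , 0≤T₀ , small = F→0 ε 0<ε in
    T₀ , 0≤T₀ , λ T T₀≤T → abs-cong (F≈G T) (small T T₀≤T)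

  vanishes-0 : Vanishes (λ _ → 0#)
  vanishes-0 ε 0<ε = 0# , ≤-reflexive refl , λ _ _ → abs-0 0<ε

  vanishes-+ : ∀ {F G} → Vanishes F → Vanishes G → Vanishes (λ T → F T + G T)
  vanishes-+ F→0 G→0 ε 0<ε =
    let T₁ , 0≤T₁ , small₁ = F→0 (ε * ½) (*-pos 0<ε 0<½)
        T₂ , 0≤T₂ , small₂ = G→0 (ε * ½) (*-pos 0<ε 0<½)
    in T₁ + T₂ , nonneg-+ 0≤T₁ 0≤T₂ , λ T T₁+T₂≤T →
      abs-congʳ (½+½-split ε) (abs-+
        (small₁ T (≤-trans (≤-+ʳ 0≤T₂) T₁+T₂≤T))
        (small₂ T (≤-trans (≤-+ˡ 0≤T₁) T₁+T₂≤T)))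

  vanishes-* : ∀ k {F} → Vanishes F → Vanishes (λ T → k * F T)
  vanishes-* k F→0 ε 0<ε =
    let M , k<M = abs<-exists k
        0<M = abs<⇒pos k<M
        T₀ , 0≤T₀ , small = F→0 (ε * inverse 0<M) (*-pos 0<ε (inverse-pos 0<M))
    in T₀ , 0≤T₀ , λ T T₀≤T → abs-congʳ (*-cancel-inverse 0<M ε)
      (abs-* k<M (small T T₀≤T))

  exp-neg-expTerm-nonneg : ∀ {T} → 0# ≤ T → ∀ k → 0# ≤ exp (- T) * expTerm T k
  exp-neg-expTerm-nonneg 0≤T k =
    nonneg-* (SmoothFunctions.exp-neg-nonneg R _ 0≤T) (expTerm-nonneg 0≤T k)

  exp-neg-expTerm≤1 : ∀ {T} → 0# ≤ T → ∀ k → 0# ≤ 1# - exp (- T) * expTerm T k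
  exp-neg-expTerm≤1 {T} 0≤T k = ≤-resp refl
    (trans (solve 3 (λ e a b → e :* (a :- b) := e :* a :- e :* b) refl (exp (- T)) (exp T) (expTerm T k))
      (+-congʳ (exp-neg-inverse)))
    (nonneg-* exp-neg-nonneg (expTerm≤exp 0≤T k))
    where open SmoothFunctions R T 0≤T using (exp-neg-inverse; exp-neg-nonneg)

  -- A further factor `T` raises the term to index `k + 1` at the cost of the factor `k + 1`, and
  -- `e⁻ᵀ` times that term is at most 1.
  exp-neg-expTerm-bound : ∀ {T} → 0# ≤ T → ∀ k → exp (- T) * expTerm T k * T ≤ suc k · 1#
  exp-neg-expTerm-bound {T} 0≤T k = nonneg⇒≤ (≤-resp refl (begin
    n * (1# - E * expTerm T (suc k))
      ≈⟨ solve 3 (λ n e a → n :* (con (ℤ.+ 1) :- e :* a) := n :- e :* (n :* a)) refl n E _ ⟩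
    n - E * (n * expTerm T (suc k))   ≈⟨ +-congˡ (-‿cong (*-congˡ (*-expTerm T k))) ⟨
    n - E * (T * expTerm T k)
      ≈⟨ +-congˡ (-‿cong (solve 3 (λ e t a → e :* (t :* a) := e :* a :* t) refl E T _)) ⟩
    n - E * expTerm T k * T           ∎)
    (nonneg-* (<⇒≤ (0<n·1 (suc k))) (exp-neg-expTerm≤1 0≤T (suc k))))
    where
    n = suc k · 1#
    E = exp (- T)

  vanishes-expTerm : ∀ k → Vanishes (λ T → exp (- T) * expTerm T k)
  vanishes-expTerm k ε 0<ε = T₀ , <⇒≤ 0<T₀ , small
    where
    -- `k + 2` instead of the bound `k + 1` makes the comparison strict: the value times `T` is at
    -- most `k + 1`, which is less than `N ≈ ε * T₀`, and that is at most `ε * T`.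
    N = suc (suc k) · 1#
    T₀ = N * inverse 0<ε
    0<T₀ : 0# < T₀
    0<T₀ = *-pos (0<n·1 (suc (suc k))) (inverse-pos 0<ε)
    εT₀≈N : ε * T₀ ≈ N
    εT₀≈N = *-cancel-inverse 0<ε N
    small : ∀ T → T₀ ≤ T → ∣ exp (- T) * expTerm T k ∣< ε
    small T T₀≤T = abs≤⇒abs< (abs≤-nonneg (exp-neg-expTerm-nonneg (<⇒≤ 0<T) k))
      (*-cancelʳ-< 0<T (≤-<-trans (exp-neg-expTerm-bound (<⇒≤ 0<T) k)
        (<-≤-trans (<-respˡ-≈ (+-identityˡ _) (+-monoˡ-< (suc k · 1#) 0<1))
          (≤-resp εT₀≈N refl (nonneg⇒≤ (≤-resp refl
            (solve 3 (λ e t t₀ → e :* (t :- t₀) := e :* t :- e :* t₀) refl ε T T₀)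
            (nonneg-* (<⇒≤ 0<ε) (≤⇒nonneg T₀≤T))))))))
      where
      0<T : 0# < T
      0<T = <-≤-trans 0<T₀ T₀≤T

  vanishes-expSum : ∀ n → Vanishes (λ T → exp (- T) * expSum T n)
  vanishes-expSum zero    = vanishes-cong (λ _ → sym (zeroʳ _)) vanishes-0
  vanishes-expSum (suc n) = vanishes-cong (λ _ → sym (distribˡ _ _ _))
    (vanishes-+ (vanishes-expSum n) (vanishes-expTerm n))

-- Finite sums and polynomial evaluation

module FiniteSums {c ℓ : Level} (R : CommutativeRing c ℓ) where
  open CommutativeRing R
  open FiniteSum rawRing
  open RawSemiringOps (RawRing.rawSemiring rawRing) using (_^_)
  open IntegerCoefficients R using (solve; _:=_; _:*_)
  open SetoidReasoning setoid

  ∑-cong : ∀ {u v} n → (∀ i → u i ≈ v i) → ∑< n u ≈ ∑< n v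
  ∑-cong zero    u≈v = refl
  ∑-cong (suc n) u≈v = +-cong (∑-cong n u≈v) (u≈v n)

  ∑-distribˡ : ∀ a u n → a * ∑< n u ≈ ∑< n (λ i → a * u i)
  ∑-distribˡ a u zero    = zeroʳ a
  ∑-distribˡ a u (suc n) = trans (distribˡ a _ _) (+-congʳ (∑-distribˡ a u n))

  ∑-suc : ∀ u n → ∑< (suc n) u ≈ u 0 + ∑< n (λ i → u (suc i))
  ∑-suc u zero    = +-comm _ _
  ∑-suc u (suc n) = trans (+-congʳ (∑-suc u n)) (+-assoc _ _ _)

  module _ {a ℓ′ : Level} (A : RawRing a ℓ′) where
    open Evaluation A rawRing
    open Polynomials A using (coeff)

    -- Unrolls Horner's scheme into a sum over the range `length p`, the one used by
    -- `evaluate-sD⁻¹`, so that the two sides can be compared term by term.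
    eval-as-sum : ∀ φ b p → eval φ b p ≈ ∑< (length p) (λ k → φ (coeff p k) * b ^ k)
    eval-as-sum φ b []      = refl
    eval-as-sum φ b (d ∷ p) = sym (begin
      ∑< (suc (length p)) (λ k → φ (coeff (d ∷ p) k) * b ^ k)
        ≈⟨ ∑-suc _ (length p) ⟩
      φ d * 1# + ∑< (length p) (λ k → φ (coeff p k) * (b * b ^ k))
        ≈⟨ +-cong (*-identityʳ (φ d)) (∑-cong (length p) λ k →
             solve 3 (λ w b e → w :* (b :* e) := b :* (w :* e)) refl _ b (b ^ k)) ⟩
      φ d + ∑< (length p) (λ k → b * (φ (coeff p k) * b ^ k))
        ≈⟨ +-congˡ (∑-distribˡ b _ (length p)) ⟨
      φ d + b * ∑< (length p) (λ k → φ (coeff p k) * b ^ k)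
        ≈⟨ +-congˡ (*-congˡ (eval-as-sum φ b p)) ⟨
      φ d + b * eval φ b p ∎)

-- The commutative ring of complex numbers

module ComplexNumbers {c ℓ₁ ℓ₂ ℓ₃ : Level} (R : RealNumbers c ℓ₁ ℓ₂ ℓ₃) where
  open RealNumbers R
  open Complex R
  open RawSemiringOps (RawRing.rawSemiring complexRing) using () renaming (_^_ to _^ᶜ_)
  open IntegerCoefficients commutativeRing using (solve; con; _:=_; _:+_; _:*_; _:-_; :-_)

  complexCommutativeRing : CommutativeRing c ℓ₁
  complexCommutativeRing = record
    { RawRing complexRing
    ; isCommutativeRing = record
      { isRing = record
        { +-isAbelianGroup = record
          { isGroup = record
            { isMonoid = record
              { isSemigroup = record
                { isMagma = record
                  { isEquivalence = record
                    { refl  = refl , refl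
                    ; sym   = λ (p , q) → sym p , sym q
                    ; trans = λ (p , q) (p′ , q′) → trans p p′ , trans q q′
                    }
                  ; ∙-cong = λ (p , q) (p′ , q′) → +-cong p p′ , +-cong q q′
                  }
                ; assoc = λ _ _ _ → +-assoc _ _ _ , +-assoc _ _ _
                }
              ; identity = (λ _ → +-identityˡ _ , +-identityˡ _) ,
                           (λ _ → +-identityʳ _ , +-identityʳ _)
              }
            ; inverse = (λ _ → -‿inverseˡ _ , -‿inverseˡ _) ,
                        (λ _ → -‿inverseʳ _ , -‿inverseʳ _)
            ; ⁻¹-cong = λ (p , q) → -‿cong p , -‿cong q
            }
          ; comm = λ _ _ → +-comm _ _ , +-comm _ _
          }
        ; *-cong = λ (p , q) (p′ , q′) →
            +-cong (*-cong p p′) (-‿cong (*-cong q q′)) , +-cong (*-cong p q′) (*-cong q p′)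
        ; *-assoc = λ (a +i a′) (b +i b′) (d +i d′) →
            solve 6 (λ a a′ b b′ d d′ →
              (a :* b :- a′ :* b′) :* d :- (a :* b′ :+ a′ :* b) :* d′ :=
              a :* (b :* d :- b′ :* d′) :- a′ :* (b :* d′ :+ b′ :* d)) refl a a′ b b′ d d′ ,
            solve 6 (λ a a′ b b′ d d′ →
              (a :* b :- a′ :* b′) :* d′ :+ (a :* b′ :+ a′ :* b) :* d :=
              a :* (b :* d′ :+ b′ :* d) :+ a′ :* (b :* d :- b′ :* d′)) refl a a′ b b′ d d′
        ; *-identity =
            (λ (a +i a′) →
              solve 2 (λ a a′ → con (ℤ.+ 1) :* a :- con (ℤ.+ 0) :* a′ := a) refl a a′ ,
              solve 2 (λ a a′ → con (ℤ.+ 1) :* a′ :+ con (ℤ.+ 0) :* a := a′) refl a a′) ,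
            (λ (a +i a′) →
              solve 2 (λ a a′ → a :* con (ℤ.+ 1) :- a′ :* con (ℤ.+ 0) := a) refl a a′ ,
              solve 2 (λ a a′ → a :* con (ℤ.+ 0) :+ a′ :* con (ℤ.+ 1) := a′) refl a a′)
        ; distrib =
            (λ (a +i a′) (b +i b′) (d +i d′) →
              solve 6 (λ a a′ b b′ d d′ → a :* (b :+ d) :- a′ :* (b′ :+ d′) :=
                (a :* b :- a′ :* b′) :+ (a :* d :- a′ :* d′)) refl a a′ b b′ d d′ ,
              solve 6 (λ a a′ b b′ d d′ → a :* (b′ :+ d′) :+ a′ :* (b :+ d) :=
                (a :* b′ :+ a′ :* b) :+ (a :* d′ :+ a′ :* d)) refl a a′ b b′ d d′) ,
            (λ (a +i a′) (b +i b′) (d +i d′) →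
              solve 6 (λ a a′ b b′ d d′ → (b :+ d) :* a :- (b′ :+ d′) :* a′ :=
                (b :* a :- b′ :* a′) :+ (d :* a :- d′ :* a′)) refl a a′ b b′ d d′ ,
              solve 6 (λ a a′ b b′ d d′ → (b :+ d) :* a′ :+ (b′ :+ d′) :* a :=
                (b :* a′ :+ b′ :* a) :+ (d :* a′ :+ d′ :* a)) refl a a′ b b′ d d′)
        }
      ; *-comm = λ (a +i a′) (b +i b′) →
          solve 4 (λ a a′ b b′ → a :* b :- a′ :* b′ := b :* a :- b′ :* a′) refl a a′ b b′ ,
          solve 4 (λ a a′ b b′ → a :* b′ :+ a′ :* b := b :* a′ :+ b′ :* a) refl a a′ b b′
      }
    }

  fromℝ-cong : ∀ {x y} → x ≈ y → fromℝ x ℂ-Ring.≈ fromℝ y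
  fromℝ-cong x≈y = x≈y , refl

  fromℝ-* : ∀ x y → fromℝ (x * y) ℂ-Ring.≈ fromℝ x ℂ-Ring.* fromℝ y
  fromℝ-* x y =
    solve 2 (λ x y → x :* y := x :* y :- con (ℤ.+ 0) :* con (ℤ.+ 0)) refl x y ,
    solve 2 (λ x y → con (ℤ.+ 0) := x :* con (ℤ.+ 0) :+ con (ℤ.+ 0) :* y) refl x y

  fromℝ-^ : ∀ x k → fromℝ (x ^ k) ℂ-Ring.≈ fromℝ x ^ᶜ k
  fromℝ-^ x zero    = refl , refl
  fromℝ-^ x (suc k) = ℂᶜ.trans (fromℝ-* x (x ^ k)) (ℂᶜ.*-congˡ {fromℝ x} (fromℝ-^ x k))
    where module ℂᶜ = CommutativeRing complexCommutativeRing

  re-*-fromℝ : ∀ w x → re (w ℂ-Ring.* fromℝ x) ≈ re w * x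
  re-*-fromℝ (a +i b) x = solve 3 (λ a b x → a :* x :- b :* con (ℤ.+ 0) := a :* x) refl a b x

  im-*-fromℝ : ∀ w x → im (w ℂ-Ring.* fromℝ x) ≈ im w * x
  im-*-fromℝ (a +i b) x = solve 3 (λ a b x → a :* con (ℤ.+ 0) :+ b :* x := b :* x) refl a b x

-- Complex integrals of gamma type over the half-line

module ComplexIntegrals {c ℓ₁ ℓ₂ ℓ₃ : Level} (R : RealNumbers c ℓ₁ ℓ₂ ℓ₃) where
  open RealNumbers R
  open OrderedField R
  open RealExponential R
  open Inequalities R
  open ExponentialBounds R
  open Decay R
  open Complex R
  open ComplexNumbers R
  open Integration R
  open FiniteSums commutativeRing using (∑-cong)
  open FiniteSum rawRing using () renaming (∑< to ∑ʳ<)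
  open FiniteSum complexRing
  open IntegerCoefficients commutativeRing using (solve; con; _:=_; _:+_; _:*_; _:-_; :-_)
  open TaggedPartition using (size; tag; width)

  re-∑ : ∀ u n → re (∑< n u) ≡.≡ ∑ʳ< n (λ i → re (u i))
  re-∑ u zero    = ≡.refl
  re-∑ u (suc n) = ≡.cong (_+ re (u n)) (re-∑ u n)

  im-∑ : ∀ u n → im (∑< n u) ≡.≡ ∑ʳ< n (λ i → im (u i))
  im-∑ u zero    = ≡.refl
  im-∑ u (suc n) = ≡.cong (_+ im (u n)) (im-∑ u n)

  within-intro : ∀ {ε w v} → ∣ re w - re v ∣< (ε * ½) → ∣ im w - im v ∣< (ε * ½) → Within ε w v
  -- With `h = ε / 2` the sum of the two squares is below `2h²`, which is less than `4h² = ε²`.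
  within-intro {ε} {w} {v} p q = <-respˡ-≈ (+-cong (square _) (square _)) (<-respʳ-≈ half²
    (<-trans (+-mono-< (proj₂ (abs-* p p)) (proj₂ (abs-* q q)))
      (<-respˡ-≈ (+-identityʳ _) (+-monoʳ-< (h * h + h * h) (pos+pos 0<h² 0<h²)))))
    where
    h = ε * ½
    0<h² : 0# < h * h
    0<h² = *-pos (abs<⇒pos p) (abs<⇒pos p)
    square : ∀ x → x * x ≈ x ^ 2
    square x = *-congˡ (sym (*-identityʳ x))
    half² : (h * h + h * h) + (h * h + h * h) ≈ ε ^ 2
    half² = trans (solve 1 (λ h → (h :* h :+ h :* h) :+ (h :* h :+ h :* h) := (h :+ h) :* (h :+ h)) refl h)
      (trans (*-cong (½+½-split ε) (½+½-split ε)) (square ε))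

  infixl 6 _-ᶜ_
  _-ᶜ_ : ℂ → ℂ → ℂ
  w -ᶜ v = w ℂ-Ring.+ ℂ-Ring.- v

  module _ (T : Carrier) (0≤T : 0# ≤ T) where
    open SmoothFunctions R T 0≤T
    open FundamentalTheorem R T 0≤T

    Smoothᶜ : (F f : Carrier → ℂ) → Set (c ⊔ ℓ₃)
    Smoothᶜ F f = Smooth (λ s → re (F s)) (λ s → re (f s)) × Smooth (λ s → im (F s)) (λ s → im (f s))

    fundamentalTheoremᶜ : ∀ {F f} → Smoothᶜ F f → HasIntegral 0# T f (F T -ᶜ F 0#)
    fundamentalTheoremᶜ {F} {f} (reF , imF) ε 0<ε = δ , 0<δ , λ P mesh → within-intro
      (abs-cong (+-congʳ (sym (re-sum P)))
        (abs≤⇒abs< (fundamentalTheorem reF P mesh) (error< K₁ K₂ refl K₂.errorBound-nonneg)))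
      (abs-cong (+-congʳ (sym (im-sum P)))
        (abs≤⇒abs< (fundamentalTheorem imF P mesh) (error< K₂ K₁ (+-comm K₂ K₁) K₁.errorBound-nonneg)))
      where
      module K₁ = Smooth reF
      module K₂ = Smooth imF
      K₁ = K₁.errorBound
      K₂ = K₂.errorBound
      0<D : 0# < 1# + (K₁ + K₂) * T
      0<D = pos+nonneg 0<1 (nonneg-* (nonneg-+ K₁.errorBound-nonneg K₂.errorBound-nonneg) 0≤T)
      -- One `δ` must serve the real and the imaginary part: `K₁ + K₂` dominates both error
      -- constants, and the added `1#` keeps the divisor positive and the final inequality strict.
      δ = ε * ½ * inverse 0<D
      0<δ : 0# < δ
      0<δ = *-pos (*-pos 0<ε 0<½) (inverse-pos 0<D)
      error< : ∀ K K′ → K + K′ ≈ K₁ + K₂ → 0# ≤ K′ → K * δ * T < ε * ½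
      error< K K′ K+K′ 0≤K′ = <-respʳ-≈
        (trans (*-congʳ (+-congˡ (*-congʳ K+K′))) (*-cancel-inverse 0<D (ε * ½)))
        (pos⇒< (<-respʳ-≈
          (solve 4 (λ k k′ d t → d :+ k′ :* t :* d := (con (ℤ.+ 1) :+ (k :+ k′) :* t) :* d :- k :* d :* t)
            refl K K′ δ T)
          (pos+nonneg 0<δ (nonneg-* (nonneg-* 0≤K′ 0≤T) (<⇒≤ 0<δ)))))
      re-sum : ∀ P → re (riemannSum f P) ≈ ∑ʳ< (size P) (λ i → re (f (tag P i)) * width P i)
      re-sum P = trans (reflexive (re-∑ _ (size P))) (∑-cong (size P) (λ i → re-*-fromℝ (f (tag P i)) _))
      im-sum : ∀ P → im (riemannSum f P) ≈ ∑ʳ< (size P) (λ i → im (f (tag P i)) * width P i)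
      im-sum P = trans (reflexive (im-∑ _ (size P))) (∑-cong (size P) (λ i → im-*-fromℝ (f (tag P i)) _))

    -- By the product rule the derivative is `E * (S + e) - E * S` with `S = expSum s k` and
    -- `e = expTerm s k`, so only the last term remains.
    smooth-gammaTerm : ∀ k →
      Smooth (λ s → - (exp (- s) * expSum s (suc k))) (λ s → exp (- s) * expTerm s k)
    smooth-gammaTerm k = smooth-cong (λ s → -1*x≈-x _)
      (λ s → solve 3 (λ E S e → (:- con (ℤ.+ 1)) :* ((:- E) :* (S :+ e) :+ E :* S) := E :* e) refl
        (exp (- s)) (expSum s k) (expTerm s k))
      (smooth-scale (- 1#) (smooth-* smooth-exp-neg (smooth-expSum k)))

  module _ (a : ℕ → ℂ) where
    -- The functions `e⁻ˢ sᵏ / k!` are the densities of the gamma distributions of shape `k + 1`;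
    -- `a` gives their weights.
    gammaIntegrand gammaPrimitive : ℕ → Carrier → ℂ
    gammaIntegrand n s = ∑< n λ k → a k ℂ-Ring.* fromℝ (exp (- s) * expTerm s k)
    gammaPrimitive n s = ∑< n λ k → a k ℂ-Ring.* fromℝ (- (exp (- s) * expSum s (suc k)))

    smooth-gamma : ∀ T 0≤T n → Smoothᶜ T 0≤T (gammaPrimitive n) (gammaIntegrand n)
    smooth-gamma T 0≤T zero    = smooth-const 0# , smooth-const 0#
      where open SmoothFunctions R T 0≤T
    smooth-gamma T 0≤T (suc n) =
      smooth-+ (proj₁ (smooth-gamma T 0≤T n)) (smooth-cong
        (λ _ → sym (re-*-fromℝ (a n) _)) (λ _ → sym (re-*-fromℝ (a n) _))
        (smooth-scale (re (a n)) (smooth-gammaTerm T 0≤T n))) ,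
      smooth-+ (proj₂ (smooth-gamma T 0≤T n)) (smooth-cong
        (λ _ → sym (im-*-fromℝ (a n) _)) (λ _ → sym (im-*-fromℝ (a n) _))
        (smooth-scale (im (a n)) (smooth-gammaTerm T 0≤T n)))
      where open SmoothFunctions R T 0≤T

    vanishes-gammaTerm : ∀ k x → Vanishes (λ T → x * - (exp (- T) * expSum T (suc k)))
    vanishes-gammaTerm k x = vanishes-cong
      (λ T → solve 2 (λ x y → (:- x) :* y := x :* (:- y)) refl x (exp (- T) * expSum T (suc k)))
      (vanishes-* (- x) (vanishes-expSum (suc k)))

    vanishes-gamma : ∀ n →
      Vanishes (λ T → re (gammaPrimitive n T)) × Vanishes (λ T → im (gammaPrimitive n T))
    vanishes-gamma zero    = vanishes-0 , vanishes-0
    vanishes-gamma (suc n) =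
      vanishes-+ (proj₁ (vanishes-gamma n)) (vanishes-cong
        (λ _ → sym (re-*-fromℝ (a n) _)) (vanishes-gammaTerm n (re (a n)))) ,
      vanishes-+ (proj₂ (vanishes-gamma n)) (vanishes-cong
        (λ _ → sym (im-*-fromℝ (a n) _)) (vanishes-gammaTerm n (im (a n))))

    -- At 0 a nonempty partial sum of exp equals 1, so each summand is `- a k`. The integral is thus
    -- read off at its lower end point.
    gammaPrimitive-0 : ∀ n → gammaPrimitive n 0# ℂ-Ring.+ ∑< n a ℂ-Ring.≈ ℂ-Ring.0#
    gammaPrimitive-0 zero    = +-identityʳ 0# , +-identityʳ 0#
    gammaPrimitive-0 (suc n) = let p , q = gammaPrimitive-0 n in
      combine p (trans (re-*-fromℝ (a n) _) (*-congˡ value)) ,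
      combine q (trans (im-*-fromℝ (a n) _) (*-congˡ value))
      where
      value : - (exp (- 0#) * expSum 0# (suc n)) ≈ - 1#
      value = -‿cong (trans (*-cong (trans (exp-cong -0#≈0#) exp-0) (expSum-zeroˡ n)) (*-identityˡ 1#))
      combine : ∀ {x y u v} → x + y ≈ 0# → u ≈ v * - 1# → (x + u) + (y + v) ≈ 0#
      combine {x} {y} {u} {v} x+y≈0 u≈-v = trans (+-congʳ (+-congˡ u≈-v))
        (trans (solve 3 (λ x y v → (x :+ v :* (:- con (ℤ.+ 1))) :+ (y :+ v) := x :+ y) refl x y v) x+y≈0)

    hasIntegral₀^∞ : ∀ {φ I} n → (∀ s → φ s ℂ-Ring.≈ gammaIntegrand n s) → I ℂ-Ring.≈ ∑< n a →
      HasIntegral₀^∞ φ I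
    hasIntegral₀^∞ {φ} {I} n φ≈ I≈ = record
      { partial     = λ T _ → gammaPrimitive n T -ᶜ gammaPrimitive n 0#
      ; isIntegral  = λ T 0≤T → let open SmoothFunctions R T 0≤T in fundamentalTheoremᶜ T 0≤T
          ( smooth-cong (λ _ → refl) (λ s → sym (proj₁ (φ≈ s))) (proj₁ (smooth-gamma T 0≤T n))
          , smooth-cong (λ _ → refl) (λ s → sym (proj₂ (φ≈ s))) (proj₂ (smooth-gamma T 0≤T n)))
      ; convergence = λ ε 0<ε →
          let T₁ , 0≤T₁ , small₁ = proj₁ (vanishes-gamma n) (ε * ½) (*-pos 0<ε 0<½)
              T₂ , 0≤T₂ , small₂ = proj₂ (vanishes-gamma n) (ε * ½) (*-pos 0<ε 0<½)
          in T₁ + T₂ , λ T _ T₁+T₂≤T → within-intro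
            (abs-cong (tail (proj₁ I≈) (proj₁ (gammaPrimitive-0 n)))
              (small₁ T (≤-trans (≤-+ʳ 0≤T₂) T₁+T₂≤T)))
            (abs-cong (tail (proj₂ I≈) (proj₂ (gammaPrimitive-0 n)))
              (small₂ T (≤-trans (≤-+ˡ 0≤T₁) T₁+T₂≤T)))
      }
      where
      -- Since the claimed value is minus the primitive at 0, the distance of the partial integral
      -- from it is the primitive at `T`, which vanishes at infinity.
      tail : ∀ {x y i s} → i ≈ s → y + s ≈ 0# → x ≈ x + - y - i
      tail {x} {y} {i} {s} i≈s y+s≈0 = sym (trans (+-congˡ (-‿cong i≈s))
        (trans (solve 3 (λ x y s → x :+ (:- y) :- s := x :- (y :+ s)) refl x y s)
          (trans (+-congˡ (trans (-‿cong y+s≈0) -0#≈0#)) (+-identityʳ x))))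

-- Powers of the inverse derivative applied to 1

module InverseDerivative {c ℓ₁ ℓ₂ ℓ₃ : Level} (R : RealNumbers c ℓ₁ ℓ₂ ℓ₃) where
  open OrderedField R using (1/_; 1/factorial)
  open RealExponential R using (1/factorial-suc)
  open ExponentialBounds R using (1/1≈1)
  open LegendreGouldHopper R using (evaluate₁; D⁻¹; module ℂ[z])
  open Complex R using (ℂ; fromℝ; complexRing)
  open ComplexNumbers R
  open CommutativeRing complexCommutativeRing hiding (zero)
  open RawSemiringOps (RawRing.rawSemiring complexRing) using (_^_)
  open IntegerCoefficients complexCommutativeRing using (solve; con; _:=_; _:+_; _:*_)
  open SetoidReasoning setoid

  -- The function local to the definition of D⁻¹ has no name outside it;
  -- generalising the index 0 to j lets unification recover it.
  mutual
    antidivide : ℕ → List ℂ → List ℂ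
    antidivide = _

    D⁻¹≡∷ : ∀ p → D⁻¹ p ≡.≡ 0# ∷ antidivide 0 p
    D⁻¹≡∷ p with zero
    ... | j = ≡.refl

  -- A predicate on lists instead of an equation between them, because the entries are known only up
  -- to `_≈_` while `D⁻¹` acts on the list itself.
  data Monomial : ℕ → ℂ → List ℂ → Set (c ⊔ ℓ₁) where
    [_] : ∀ {w a} → w ≈ a → Monomial 0 a (w ∷ [])
    _∷_ : ∀ {k w a p} → w ≈ 0# → Monomial k a p → Monomial (suc k) a (w ∷ p)

  monomial-cong : ∀ {k a b p} → a ≈ b → Monomial k a p → Monomial k b p
  monomial-cong a≈b [ w≈a ]    = [ trans w≈a a≈b ]
  monomial-cong a≈b (w≈0 ∷ m) = w≈0 ∷ monomial-cong a≈b m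

  evaluate-monomial : ∀ z {k a p} → Monomial k a p → evaluate₁ z p ≈ a * z ^ k
  evaluate-monomial z {a = a} {w ∷ []} [ w≈a ] = trans (+-congʳ w≈a)
    (solve 2 (λ a z → a :+ z :* con (ℤ.+ 0) := a :* con (ℤ.+ 1)) refl a z)
  evaluate-monomial z {suc k} {a} {w ∷ p} (w≈0 ∷ m) = begin
    w + z * evaluate₁ z p   ≈⟨ +-cong w≈0 (*-congˡ {z} (evaluate-monomial z m)) ⟩
    0# + z * (a * z ^ k)
      ≈⟨ solve 3 (λ a z e → con (ℤ.+ 0) :+ z :* (a :* e) := a :* (z :* e)) refl a z (z ^ k) ⟩
    a * (z * z ^ k)         ∎

  -- Each step moves one unit from `k` to the running index `j`. The divisor met at the last entry
  -- depends on their sum only, hence the separate `n` with an equation.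
  antidivide-monomial : ∀ j {k a p n} → n ≡.≡ j ℕ.+ k → Monomial k a p →
    Monomial k (a * fromℝ (1/ suc n)) (antidivide j p)
  antidivide-monomial j {n = n} n≡ [ w≈a ] with ≡.trans n≡ (ℕₚ.+-identityʳ j)
  ... | ≡.refl = [ *-congʳ {fromℝ (1/ suc n)} w≈a ]
  antidivide-monomial j {suc k} n≡ (w≈0 ∷ m) =
    trans (*-congʳ {fromℝ (1/ suc j)} w≈0) (zeroˡ (fromℝ (1/ suc j))) ∷
    antidivide-monomial (suc j) (≡.trans n≡ (ℕₚ.+-suc j k)) m

  D⁻¹-monomial : ∀ {k a p} → Monomial k a p → Monomial (suc k) (a * fromℝ (1/ suc k)) (D⁻¹ p)
  D⁻¹-monomial {p = p} m = ≡.subst (Monomial _ _) (≡.sym (D⁻¹≡∷ p))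
    (refl ∷ antidivide-monomial 0 ≡.refl m)

  -- The divisors 1, ..., `k` of the successive antiderivatives multiply up to `k !`, matching
  -- `1/factorial-suc`.
  D⁻¹^k-monomial : ∀ k → Monomial k (fromℝ (1/factorial k)) (fold (ℂ[z].C 1#) D⁻¹ k)
  D⁻¹^k-monomial zero    = [ fromℝ-cong (RealNumbers.sym R 1/1≈1) ]
  D⁻¹^k-monomial (suc k) = monomial-cong
    (sym (trans (fromℝ-cong (1/factorial-suc k)) (fromℝ-* (1/factorial k) (1/ suc k))))
    (D⁻¹-monomial (D⁻¹^k-monomial k))

-- The Laplace integral of p(x, y, s D_z⁻¹)

module _ {c ℓ₁ ℓ₂ ℓ₃ : Level} (R : RealNumbers c ℓ₁ ℓ₂ ℓ₃) where
  open Setting R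
  open Complex R using (complexRing)
  open OrderedField R using (1/factorial)
  open RealExponential R using (expTerm)
  open ComplexNumbers R
  open ComplexIntegrals R
  open InverseDerivative R using (evaluate-monomial; D⁻¹^k-monomial)
  open FiniteSums complexCommutativeRing
  open CommutativeRing complexCommutativeRing hiding (-_)
  open RawSemiringOps (RawRing.rawSemiring complexRing) using (_^_)
  open IntegerCoefficients complexCommutativeRing using (solve; _:=_; _:*_)
  open SetoidReasoning setoid
  private module ℝ = RealNumbers R

  laplace-sD⁻¹ : ∀ x y z p → HasIntegral₀^∞
    (λ s → fromℝ (exp (- s)) * evaluate-sD⁻¹ x y (fromℝ s) z p) (evaluate₃ x y z p)
  -- The weights are `b k * z ^ k`: the `1 / k!` from `D⁻¹` joins `sᵏ` to form the gamma density,
  -- and what is left sums to the value of `p`.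
  laplace-sD⁻¹ x y z p = hasIntegral₀^∞ (λ k → b k * z ^ k) (length p)
    (λ s → trans (∑-distribˡ (fromℝ (exp (- s))) _ (length p)) (∑-cong (length p) (term s)))
    (eval-as-sum ℂ[x,y] (evaluate₂ x y) z p)
    where
    b : ℕ → ℂ
    b k = evaluate₂ x y (ℂ[xy][z].coeff p k)
    term : ∀ s k →
      fromℝ (exp (- s)) * (b k * fromℝ s ^ k * evaluate₁ z (fold (ℂ[z].C 1#) D⁻¹ k)) ≈
      b k * z ^ k * fromℝ (exp (- s) ℝ.* expTerm s k)
    term s k = begin
      E * (b k * fromℝ s ^ k * evaluate₁ z (fold (ℂ[z].C 1#) D⁻¹ k))
        ≈⟨ *-congˡ {E} (*-cong (*-congˡ {b k} (sym (fromℝ-^ s k)))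
             (evaluate-monomial z (D⁻¹^k-monomial k))) ⟩
      E * (b k * fromℝ (s ℝ.^ k) * (fromℝ (1/factorial k) * z ^ k))
        ≈⟨ solve 5 (λ e b s f z → e :* (b :* s :* (f :* z)) := b :* z :* (e :* (s :* f))) refl
             E (b k) (fromℝ (s ℝ.^ k)) (fromℝ (1/factorial k)) (z ^ k) ⟩
      b k * z ^ k * (E * (fromℝ (s ℝ.^ k) * fromℝ (1/factorial k)))
        ≈⟨ *-congˡ {b k * z ^ k} (trans (fromℝ-* _ _) (*-congˡ {E} (fromℝ-* _ _))) ⟨
      b k * z ^ k * fromℝ (exp (- s) ℝ.* expTerm s k) ∎
      where E = fromℝ (exp (- s))

theorem4p4 :
    ∀ {c ℓ₁ ℓ₂ ℓ₃ : Level} (R : RealNumbers c ℓ₁ ℓ₂ ℓ₃) →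
    let open Setting R in
    (f g : Series) → IsDelta f → IsInvertible g →
    (f⁻¹ : Series) → IsCompositionalInverse f f⁻¹ →
    (1/g∘f⁻¹ : Series) → IsReciprocal (g ∘ₛ f⁻¹) 1/g∘f⁻¹ →
    (r : ℕ) → 1 ℕ.≤ r →
    (n : ℕ) (x y z : ℂ) →
    HasIntegral₀^∞
      (λ s → fromℝ (exp (- s)) ℂ-Ring.* evaluate-sD⁻¹ x y (fromℝ s) z (LeGs f⁻¹ 1/g∘f⁻¹ r n))
      (evaluate₃ x y z (LeGs f⁻¹ 1/g∘f⁻¹ r n))
theorem4p4 R f g _ _ f⁻¹ _ 1/g∘f⁻¹ _ r _ n x y z =
  laplace-sD⁻¹ R x y z (Setting.LeGs R f⁻¹ 1/g∘f⁻¹ r n)
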